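{- There is a polynomial $p$ such that the following holds for all $\epsilon,\delta\in(0,1)$ and all $n$. Let $\mu$ be a known distribution over $[n]$ such that $\|\mu-U_n\|_\infty<\frac{\epsilon}{100n}$, where $U_n$ is the uniform distribution over $[n]$. Then identity with $\mu$ can be tested by an adaptive algorithm using at most $p(\epsilon^{ -1},\log(\delta^{ -1}))$ conditional samples: given conditional sample access to an unknown distribution $\mu'$ over $[n]$, the algorithm accepts with probability at least $1-\delta$ if $\mu'=\mu$, and rejects with probability at least $1-\delta$ if $d(\mu,\mu')\ge\epsilon$.
   Context: $[n]=\{1,\ldots,n\}$; $U_n(i)=1/n$; $\|\mu-U_n\|_\infty=\max_i|\mu(i)-1/n|$; the variation distance is $d(\mu,\mu')=\frac12\sum_{i=1}^n|\mu(i)-\mu'(i)|$. A conditional sample from $\mu'$ with a nonempty set $A\subseteq[n]$ is an element $j\in A$ drawn with probability $\mu'(j)/\mu'(A)$ if $\mu'(A)>0$, and uniformly from $A$ if $\mu'(A)=0$, independently of all previous samples. An adaptive algorithm is a randomized algorithm that may choose each conditioning set based on the previously received samples and its internal coin tosses, and finally accepts or rejects based on the received samples and its coin tosses. The algorithm is given $\mu,\epsilon,\delta,n$ explicitly. -}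

module Defs where

open import Algebra.Bundles using (CommutativeRing; Semiring)
import Algebra.Construct.NaturalChoice.Max as Max
import Algebra.Definitions.RawSemiring as RawSemiringDefinitions
import Algebra.Properties.Ring as RingProperties
import Algebra.Properties.Semiring.Exp as ExpProperties
import Algebra.Properties.Semiring.Mult as MultProperties
open import Algebra.Structures using (IsCommutativeRing)
open import Data.Bool.Base using (Bool; true; false; if_then_else_)
open import Data.Fin.Base using (Fin)
open import Data.Fin.Subset using (Subset; Nonempty; ∣_∣)
open import Data.Fin.Subset.Properties using (_∈?_)
open import Data.List.Base using (List; foldr)
import Data.Nat.Base as ℕ
open ℕ using (ℕ; zero; suc)
import Data.Nat.Properties as ℕ
open import Data.Product using (Σ; ∃; ∃-syntax; _×_; _,_; proj₁; proj₂)
open import Data.Sum.Base using (inj₁; inj₂)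
import Data.Vec.Functional as Vector
open Vector using (Vector)
open import Function.Base using (_∘_)
open import Level using (0ℓ)
open import Relation.Binary.Bundles using (DecTotalOrder)
import Relation.Binary.Construct.NonStrictToStrict as NonStrictToStrict
import Relation.Binary.Reasoning.PartialOrder as PartialOrderReasoning
open import Relation.Binary.Structures using (IsDecTotalOrder)
open import Relation.Nullary using (¬_; does; yes; no; contradiction)

-- The real numbers, axiomatised as a Dedekind-complete ordered field; such a
-- field is unique up to isomorphism.  The order is decidable, as it is
-- classically.  The Archimedean property follows classically from
-- completeness; it is listed because constructively it also supplies the
-- witness.  The value of 0# ⁻¹ is left unspecified.
record RealField : Set₁ where
  infix  4 _≈_ _≤_
  infixl 6 _+_
  infixl 7 _*_
  infix  8 -_
  infix  9 _⁻¹
  field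
    Carrier : Set
    _≈_ _≤_ : Carrier → Carrier → Set
    _+_ _*_ : Carrier → Carrier → Carrier
    -_ _⁻¹  : Carrier → Carrier
    0# 1#   : Carrier

    isCommutativeRing : IsCommutativeRing _≈_ _+_ _*_ -_ 0# 1#
    0≉1               : ¬ (0# ≈ 1#)
    ⁻¹-cong           : ∀ {x y} → x ≈ y → x ⁻¹ ≈ y ⁻¹
    ⁻¹-inverseʳ       : ∀ {x} → ¬ (x ≈ 0#) → x * x ⁻¹ ≈ 1#

    isDecTotalOrder   : IsDecTotalOrder _≈_ _≤_
    +-monoˡ-≤         : ∀ z {x y} → x ≤ y → x + z ≤ y + z
    *-nonNeg          : ∀ {x y} → 0# ≤ x → 0# ≤ y → 0# ≤ x * y

  commutativeRing : CommutativeRing 0ℓ 0ℓ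
  commutativeRing = record { isCommutativeRing = isCommutativeRing }

  decTotalOrder : DecTotalOrder 0ℓ 0ℓ 0ℓ
  decTotalOrder = record { isDecTotalOrder = isDecTotalOrder }

  open RawSemiringDefinitions
    (Semiring.rawSemiring (CommutativeRing.semiring commutativeRing)) public
    using (_^_; sum) renaming (_×_ to _·_)

  fromℕ : ℕ → Carrier
  fromℕ n = n · 1#

  IsUpperBound : (Carrier → Set) → Carrier → Set
  IsUpperBound P u = ∀ {x} → P x → x ≤ u

  IsSupremum : (Carrier → Set) → Carrier → Set
  IsSupremum P s = IsUpperBound P s × (∀ {u} → IsUpperBound P u → s ≤ u)

  field
    archimedean : ∀ x → ∃[ n ] x ≤ fromℕ n
    complete    : (P : Carrier → Set) → ∃ P → ∃ (IsUpperBound P) →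
                  ∃ (IsSupremum P)

module RealFacts (R : RealField) where
  open RealField R renaming (Carrier to ℝ) public
  private module O = DecTotalOrder decTotalOrder
  open O public using (_≟_; _≤?_)
  open Max O.totalOrder public using (_⊔_)
  open NonStrictToStrict _≈_ _≤_ public using (_<_)
  open CommutativeRing commutativeRing public using (_-_)

  private
    module C = CommutativeRing commutativeRing
    open RingProperties C.ring using (-‿distribʳ-*; -‿involutive)
    open ExpProperties C.semiring using (^-homo-*; ^-assocʳ)
    open MultProperties C.semiring using (×-homo-+; ×1-homo-*)
    open PartialOrderReasoning O.poset

    2# : ℝ
    2# = fromℕ 2

    +-monoʳ-≤ : ∀ z {x y} → x ≤ y → z + x ≤ z + y
    +-monoʳ-≤ z {x} {y} x≤y = begin
      z + x ≈⟨ C.+-comm z x ⟩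
      x + z ≤⟨ +-monoˡ-≤ z x≤y ⟩
      y + z ≈⟨ C.+-comm y z ⟩
      z + y ∎

    x-y+y≈x : ∀ x y → (x - y) + y ≈ x
    x-y+y≈x x y = C.trans (C.+-assoc x (- y) y)
      (C.trans (C.+-congˡ (C.-‿inverseˡ y)) (C.+-identityʳ x))

    x≤y⇒0≤y-x : ∀ {x y} → x ≤ y → 0# ≤ y - x
    x≤y⇒0≤y-x {x} {y} x≤y = begin
      0#    ≈⟨ C.-‿inverseʳ x ⟨
      x - x ≤⟨ +-monoˡ-≤ (- x) x≤y ⟩
      y - x ∎

    *-monoʳ-≤ : ∀ z {x y} → 0# ≤ z → x ≤ y → z * x ≤ z * y
    *-monoʳ-≤ z {x} {y} 0≤z x≤y = begin
      z * x                   ≈⟨ C.+-identityˡ _ ⟨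
      0# + z * x              ≤⟨ +-monoˡ-≤ (z * x) (*-nonNeg 0≤z (x≤y⇒0≤y-x x≤y)) ⟩
      z * (y - x) + z * x     ≈⟨ C.distribˡ z (y - x) x ⟨
      z * ((y - x) + x)       ≈⟨ C.*-congˡ (x-y+y≈x y x) ⟩
      z * y                   ∎

    *-monoˡ-≤ : ∀ z {x y} → 0# ≤ z → x ≤ y → x * z ≤ y * z
    *-monoˡ-≤ z {x} {y} 0≤z x≤y = begin
      x * z ≈⟨ C.*-comm x z ⟩
      z * x ≤⟨ *-monoʳ-≤ z 0≤z x≤y ⟩
      z * y ≈⟨ C.*-comm z y ⟩
      y * z ∎

    x≤0⇒0≤-x : ∀ {x} → x ≤ 0# → 0# ≤ - x
    x≤0⇒0≤-x {x} x≤0 = begin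
      0#      ≤⟨ x≤y⇒0≤y-x x≤0 ⟩
      0# - x  ≈⟨ C.+-identityˡ (- x) ⟩
      - x     ∎

    0≤1 : 0# ≤ 1#
    0≤1 with O.total 0# 1#
    ... | inj₁ 0≤1 = 0≤1
    ... | inj₂ 1≤0 = begin
      0#            ≤⟨ *-nonNeg (x≤0⇒0≤-x 1≤0) (x≤0⇒0≤-x 1≤0) ⟩
      - 1# * - 1#   ≈⟨ -‿distribʳ-* (- 1#) 1# ⟨
      - (- 1# * 1#) ≈⟨ C.-‿cong (C.*-identityʳ (- 1#)) ⟩
      - - 1#        ≈⟨ -‿involutive 1# ⟩
      1#            ∎

    1≰0 : ¬ (1# ≤ 0#)
    1≰0 1≤0 = 0≉1 (O.antisym 0≤1 1≤0)

    fromℕ-nonNeg : ∀ n → 0# ≤ fromℕ n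
    fromℕ-nonNeg zero    = O.refl
    fromℕ-nonNeg (suc n) = begin
      0#            ≤⟨ fromℕ-nonNeg n ⟩
      fromℕ n       ≈⟨ C.+-identityˡ _ ⟨
      0# + fromℕ n  ≤⟨ +-monoˡ-≤ (fromℕ n) 0≤1 ⟩
      fromℕ (suc n) ∎

    fromℕ-mono : ∀ {m n} → m ℕ.≤ n → fromℕ m ≤ fromℕ n
    fromℕ-mono {n = n} ℕ.z≤n   = fromℕ-nonNeg n
    fromℕ-mono (ℕ.s≤s m≤n)     = +-monoʳ-≤ 1# (fromℕ-mono m≤n)

    1≤fromℕ[1+n] : ∀ n → 1# ≤ fromℕ (suc n)
    1≤fromℕ[1+n] n = begin
      1#            ≈⟨ C.+-identityʳ 1# ⟨
      fromℕ 1       ≤⟨ fromℕ-mono (ℕ.s≤s (ℕ.z≤n {n})) ⟩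
      fromℕ (suc n) ∎

    fromℕ[1+n]≉0 : ∀ n → ¬ (fromℕ (suc n) ≈ 0#)
    fromℕ[1+n]≉0 n eq = 1≰0 (O.trans (1≤fromℕ[1+n] n) (O.reflexive eq))

    2*x≈x+x : ∀ x → 2# * x ≈ x + x
    2*x≈x+x x = C.trans (C.*-congʳ (C.+-congˡ (C.+-identityʳ 1#)))
      (C.trans (C.distribʳ x 1# 1#)
        (C.+-cong (C.*-identityˡ x) (C.*-identityˡ x)))

    1≤2^n : ∀ n → 1# ≤ 2# ^ n
    1≤2^n zero    = O.refl
    1≤2^n (suc n) = begin
      1#                ≈⟨ C.+-identityʳ 1# ⟨
      1# + 0#           ≤⟨ +-monoʳ-≤ 1# (O.trans 0≤1 (1≤2^n n)) ⟩
      1# + 2# ^ n       ≤⟨ +-monoˡ-≤ (2# ^ n) (1≤2^n n) ⟩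
      2# ^ n + 2# ^ n   ≈⟨ 2*x≈x+x (2# ^ n) ⟨
      2# ^ suc n        ∎

    fromℕ≤2^n : ∀ n → fromℕ n ≤ 2# ^ n
    fromℕ≤2^n zero    = 0≤1
    fromℕ≤2^n (suc n) = begin
      1# + fromℕ n      ≤⟨ +-monoʳ-≤ 1# (fromℕ≤2^n n) ⟩
      1# + 2# ^ n       ≤⟨ +-monoˡ-≤ (2# ^ n) (1≤2^n n) ⟩
      2# ^ n + 2# ^ n   ≈⟨ 2*x≈x+x (2# ^ n) ⟨
      2# ^ suc n        ∎

    2^-cancel-≤ : ∀ {m n} → 2# ^ m ≤ 2# ^ n → m ℕ.≤ n
    2^-cancel-≤ {zero}          _  = ℕ.z≤n
    2^-cancel-≤ {suc m} {zero}  le = contradiction (begin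
      1#                  ≈⟨ C.+-identityʳ 1# ⟨
      1# + 0#             ≈⟨ C.+-congˡ (C.-‿inverseʳ 1#) ⟨
      1# + (1# - 1#)      ≈⟨ C.+-assoc 1# 1# (- 1#) ⟨
      (1# + 1#) - 1#      ≤⟨ +-monoˡ-≤ (- 1#) (begin
        1# + 1#             ≤⟨ +-monoʳ-≤ 1# (1≤2^n m) ⟩
        1# + 2# ^ m         ≤⟨ +-monoˡ-≤ (2# ^ m) (1≤2^n m) ⟩
        2# ^ m + 2# ^ m     ≈⟨ 2*x≈x+x (2# ^ m) ⟨
        2# ^ suc m          ≤⟨ le ⟩
        1#                  ∎) ⟩
      1# - 1#             ≈⟨ C.-‿inverseʳ 1# ⟩
      0#                  ∎) 1≰0
    2^-cancel-≤ {suc m} {suc n} le = ℕ.s≤s (2^-cancel-≤ (begin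
      2# ^ m                  ≈⟨ half (2# ^ m) ⟨
      2# ⁻¹ * (2# * 2# ^ m)   ≤⟨ *-monoʳ-≤ (2# ⁻¹) 0≤2⁻¹ le ⟩
      2# ⁻¹ * (2# * 2# ^ n)   ≈⟨ half (2# ^ n) ⟩
      2# ^ n                  ∎))
      where
      half : ∀ x → 2# ⁻¹ * (2# * x) ≈ x
      half x = C.trans (C.sym (C.*-assoc (2# ⁻¹) 2# x))
        (C.trans (C.*-congʳ (C.trans (C.*-comm (2# ⁻¹) 2#)
                                     (⁻¹-inverseʳ (fromℕ[1+n]≉0 1))))
                 (C.*-identityˡ x))

      0≤2⁻¹ : 0# ≤ 2# ⁻¹
      0≤2⁻¹ with O.total 0# (2# ⁻¹)
      ... | inj₁ p = p
      ... | inj₂ p = contradiction (begin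
        1#          ≈⟨ ⁻¹-inverseʳ (fromℕ[1+n]≉0 1) ⟨
        2# * 2# ⁻¹  ≤⟨ *-monoʳ-≤ 2# (fromℕ-nonNeg 2) p ⟩
        2# * 0#     ≈⟨ C.zeroʳ 2# ⟩
        0#          ∎) 1≰0

    ^-nonNeg : ∀ {x} n → 0# ≤ x → 0# ≤ x ^ n
    ^-nonNeg zero    0≤x = 0≤1
    ^-nonNeg (suc n) 0≤x = *-nonNeg 0≤x (^-nonNeg n 0≤x)

    ^-mono-≤ : ∀ {x y} n → 0# ≤ x → x ≤ y → x ^ n ≤ y ^ n
    ^-mono-≤             zero    0≤x x≤y = O.refl
    ^-mono-≤ {x = x} {y} (suc n) 0≤x x≤y = begin
      x * x ^ n ≤⟨ *-monoʳ-≤ x 0≤x (^-mono-≤ n 0≤x x≤y) ⟩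
      x * y ^ n ≤⟨ *-monoˡ-≤ (y ^ n) (^-nonNeg n (O.trans 0≤x x≤y)) x≤y ⟩
      y * y ^ n ∎

    0≤⁻¹ : ∀ {x} → 0# < x → 0# ≤ x ⁻¹
    0≤⁻¹ {x} (0≤x , 0≉x) with O.total 0# (x ⁻¹)
    ... | inj₁ p = p
    ... | inj₂ p = contradiction (begin
      1#        ≈⟨ ⁻¹-inverseʳ (0≉x ∘ C.sym) ⟨
      x * x ⁻¹  ≤⟨ *-monoʳ-≤ x 0≤x p ⟩
      x * 0#    ≈⟨ C.zeroʳ x ⟩
      0#        ∎) 1≰0

    x≤2^n : ∀ x → ∃[ n ] x ≤ 2# ^ n
    x≤2^n x with archimedean x
    ... | n , x≤n = n , O.trans x≤n (fromℕ≤2^n n)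

  ⁻¹-pos : ∀ {x} → 0# < x → 0# < x ⁻¹
  ⁻¹-pos {x} 0<x@(_ , 0≉x) = 0≤⁻¹ 0<x , λ 0≈x⁻¹ → 0≉1 (C.trans
    (C.sym (C.zeroʳ x))
    (C.trans (C.*-congˡ 0≈x⁻¹) (⁻¹-inverseʳ (0≉x ∘ C.sym))))

  -- The rationals q = (a - c) / (1 + b) with 2 ^ q ≤ x, the latter written
  -- without division or roots as 2 ^ a ≤ x ^ (1 + b) * 2 ^ c.
  data Log₂Cut (x : ℝ) : ℝ → Set where
    cut : ∀ a b c {q} →
          q ≈ (fromℕ a - fromℕ c) * fromℕ (suc b) ⁻¹ →
          fromℕ 2 ^ a ≤ x ^ suc b * fromℕ 2 ^ c →
          Log₂Cut x q

  private
    log₂Cut-nonempty : ∀ {x} → 0# < x → ∃ (Log₂Cut x)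
    log₂Cut-nonempty {x} (0≤x , 0≉x) with x≤2^n (x ⁻¹)
    ... | c , x⁻¹≤2^c = _ , cut 0 0 c C.refl (begin
      1#                ≈⟨ ⁻¹-inverseʳ (0≉x ∘ C.sym) ⟨
      x * x ⁻¹          ≤⟨ *-monoʳ-≤ x 0≤x x⁻¹≤2^c ⟩
      x * 2# ^ c        ≈⟨ C.*-congʳ (C.*-identityʳ x) ⟨
      x ^ 1 * 2# ^ c    ∎)

    log₂Cut-bounded : ∀ {x} → 0# < x → ∃ (IsUpperBound (Log₂Cut x))
    log₂Cut-bounded {x} (0≤x , 0≉x) with x≤2^n x
    ... | N , x≤2^N = fromℕ N , λ { (cut a b c q≈ le) → bound a b c q≈ le }
      where
      bound : ∀ a b c {q} → q ≈ (fromℕ a - fromℕ c) * fromℕ (suc b) ⁻¹ →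
              2# ^ a ≤ x ^ suc b * 2# ^ c → q ≤ fromℕ N
      bound a b c {q} q≈ le = begin
        q                        ≈⟨ q≈ ⟩
        (fromℕ a - fromℕ c) * d ⁻¹ ≤⟨ *-monoˡ-≤ (d ⁻¹) (0≤⁻¹ 0<d) a-c≤Nd ⟩
        (fromℕ N * d) * d ⁻¹     ≈⟨ C.*-assoc _ _ _ ⟩
        fromℕ N * (d * d ⁻¹)     ≈⟨ C.*-congˡ (⁻¹-inverseʳ (fromℕ[1+n]≉0 b)) ⟩
        fromℕ N * 1#             ≈⟨ C.*-identityʳ _ ⟩
        fromℕ N                  ∎
        where
        d : ℝ
        d = fromℕ (suc b)

        0<d : 0# < d
        0<d = fromℕ-nonNeg (suc b) , fromℕ[1+n]≉0 b ∘ C.sym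

        a≤ : a ℕ.≤ N ℕ.* suc b ℕ.+ c
        a≤ = 2^-cancel-≤ (begin
          2# ^ a                        ≤⟨ le ⟩
          x ^ suc b * 2# ^ c            ≤⟨ *-monoˡ-≤ (2# ^ c) (O.trans 0≤1 (1≤2^n c))
                                             (^-mono-≤ (suc b) 0≤x x≤2^N) ⟩
          (2# ^ N) ^ suc b * 2# ^ c     ≈⟨ C.*-congʳ (^-assocʳ 2# N (suc b)) ⟩
          2# ^ (N ℕ.* suc b) * 2# ^ c   ≈⟨ ^-homo-* 2# (N ℕ.* suc b) c ⟨
          2# ^ (N ℕ.* suc b ℕ.+ c)      ∎)

        a-c≤Nd : fromℕ a - fromℕ c ≤ fromℕ N * d
        a-c≤Nd = begin
          fromℕ a - fromℕ c
            ≤⟨ +-monoˡ-≤ (- fromℕ c) (fromℕ-mono a≤) ⟩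
          fromℕ (N ℕ.* suc b ℕ.+ c) - fromℕ c
            ≈⟨ C.+-congʳ (×-homo-+ 1# (N ℕ.* suc b) c) ⟩
          (fromℕ (N ℕ.* suc b) + fromℕ c) - fromℕ c
            ≈⟨ C.+-assoc _ _ _ ⟩
          fromℕ (N ℕ.* suc b) + (fromℕ c - fromℕ c)
            ≈⟨ C.+-congˡ (C.-‿inverseʳ _) ⟩
          fromℕ (N ℕ.* suc b) + 0#
            ≈⟨ C.+-identityʳ _ ⟩
          fromℕ (N ℕ.* suc b)
            ≈⟨ ×1-homo-* N (suc b) ⟩
          fromℕ N * d ∎

  -- The base is immaterial inside a polynomial bound.
  log₂ : (x : ℝ) → 0# < x → ℝ
  log₂ x 0<x = proj₁ (complete (Log₂Cut x) (log₂Cut-nonempty 0<x) (log₂Cut-bounded 0<x))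

  log₂-isSupremum : ∀ x (0<x : 0# < x) → IsSupremum (Log₂Cut x) (log₂ x 0<x)
  log₂-isSupremum x 0<x =
    proj₂ (complete (Log₂Cut x) (log₂Cut-nonempty 0<x) (log₂Cut-bounded 0<x))

module Testing (R : RealField) where
  open RealFacts R public

  -- A bivariate real polynomial as a list of monomials: (a , i , j) stands for
  -- a * x ^ i * y ^ j.
  Polynomial₂ : Set
  Polynomial₂ = List (ℝ × ℕ × ℕ)

  evaluate : Polynomial₂ → ℝ → ℝ → ℝ
  evaluate p x y = foldr (λ { (a , i , j) s → a * x ^ i * y ^ j + s }) 0# p

  ∣_∣ᵣ : ℝ → ℝ
  ∣ x ∣ᵣ = x ⊔ (- x)

  record Distribution (n : ℕ) : Set where
    field
      pmf        : Vector ℝ n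
      pmf-nonNeg : ∀ i → 0# ≤ pmf i
      pmf-sum    : sum pmf ≈ 1#
  open Distribution public

  infix 4 _≐_
  _≐_ : ∀ {n} → Distribution n → Distribution n → Set
  μ ≐ μ′ = ∀ i → pmf μ i ≈ pmf μ′ i

  U : ∀ n → Vector ℝ n
  U n i = fromℕ n ⁻¹

  -- The seed 0# of the maximum is harmless: all entries are nonnegative.
  ‖_-_‖∞ : ∀ {n} → Vector ℝ n → Vector ℝ n → ℝ
  ‖ f - g ‖∞ = Vector.foldr _⊔_ 0# (λ i → ∣ f i - g i ∣ᵣ)

  distance : ∀ {n} → Distribution n → Distribution n → ℝ
  distance μ μ′ = fromℕ 2 ⁻¹ * sum (λ i → ∣ pmf μ i - pmf μ′ i ∣ᵣ)

  mass : ∀ {n} → Distribution n → Subset n → ℝ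
  mass μ A = sum (λ i → if does (i ∈? A) then pmf μ i else 0#)

  -- Probability that a conditional sample from μ with A equals j.
  conditional : ∀ {n} → Distribution n → Subset n → Fin n → ℝ
  conditional μ A j =
    if does (j ∈? A)
    then (if does (mass μ A ≟ 0#)
          then fromℕ ∣ A ∣ ⁻¹
          else pmf μ j * mass μ A ⁻¹)
    else 0#

  -- Adaptive algorithms over Fin n, as decision trees whose every branch draws
  -- at most q conditional samples; fair coin tosses are not counted.  The
  -- continuation of a query is also given values j outside A, which are
  -- returned with probability zero.
  data Algorithm (n : ℕ) : ℕ → Set where
    accept : ∀ {q} → Algorithm n q
    reject : ∀ {q} → Algorithm n q
    toss   : ∀ {q} → (Bool → Algorithm n q) → Algorithm n q
    query  : ∀ {q} (A : Subset n) → Nonempty A →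
             (Fin n → Algorithm n q) → Algorithm n (suc q)

  Pr[_accepts_] : ∀ {n q} → Algorithm n q → Distribution n → ℝ
  Pr[ accept      accepts μ ] = 1#
  Pr[ reject      accepts μ ] = 0#
  Pr[ toss k      accepts μ ] =
    fromℕ 2 ⁻¹ * (Pr[ k true accepts μ ] + Pr[ k false accepts μ ])
  Pr[ query A _ k accepts μ ] =
    sum (λ j → conditional μ A j * Pr[ k j accepts μ ])

  Pr[_rejects_] : ∀ {n q} → Algorithm n q → Distribution n → ℝ
  Pr[ accept      rejects μ ] = 0#
  Pr[ reject      rejects μ ] = 1#
  Pr[ toss k      rejects μ ] =
    fromℕ 2 ⁻¹ * (Pr[ k true rejects μ ] + Pr[ k false rejects μ ])
  Pr[ query A _ k rejects μ ] =
    sum (λ j → conditional μ A j * Pr[ k j rejects μ ])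

  record TestsIdentity {n q} (T : Algorithm n q) (μ : Distribution n) (ε δ : ℝ) : Set where
    field
      completeness : ∀ μ′ → μ′ ≐ μ → 1# - δ ≤ Pr[ T accepts μ′ ]
      soundness    : ∀ μ′ → ε ≤ distance μ μ′ → 1# - δ ≤ Pr[ T rejects μ′ ]

{-# OPTIONS --safe #-}
module Submission where

-- Draw i uniformly with fair coins, j from the unknown distribution ν, and
-- then one sample from {i , j}.  It returns j with probability
-- ν j / (ν i + ν j), so the expected score is the mean over i of
-- Σ_j (ν j)² / (ν i + ν j), which equals 1/2 for the uniform distribution and
-- grows with the distance from it: a tangent-line bound gives at least
-- 1/2 + ε²/8 if ν is ε-far from μ, while a distribution as close to uniform as
-- μ scores at most 1/2 + ε²/16.  Hence two samples tell the cases apart with a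
-- constant times ε² of advantage, and independent repetitions amplify this by
-- an exponential-moment bound.  The advantage does not depend on n.

open import Defs
open import Algebra.Bundles using (CommutativeRing)
import Algebra.Construct.NaturalChoice.Max as Max
import Algebra.Properties.CommutativeMonoid.Sum as SumProperties
import Algebra.Properties.CommutativeSemiring.Exp as CommutativeExpProperties
import Algebra.Properties.Ring as RingProperties
import Algebra.Properties.Semiring.Exp as ExpProperties
import Algebra.Properties.Semiring.Mult as MultProperties
import Algebra.Properties.Semiring.Sum as SemiringSumProperties
import Algebra.Solver.Ring as RingSolver
open import Algebra.Solver.Ring.AlmostCommutativeRing
  using (AlmostCommutativeRing; fromCommutativeRing; _-Raw-AlmostCommutative⟶_)
open import Data.Bool.Base using (Bool; true; false; if_then_else_; _∨_)
open import Data.Bool.Properties using (∨-zeroʳ)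
open import Data.Fin.Base as Fin using (Fin; toℕ)
import Data.Fin.Properties as Fin
open import Data.Fin.Subset using (Subset; Nonempty; ⊤; ∣_∣; _∈_)
open import Data.Fin.Subset.Properties using (_∈?_; ∈⊤; drop-there)
open import Data.Integer.Base as ℤ using (ℤ; +_; -[1+_])
import Data.Integer.Properties as ℤ
open import Data.List.Base using (_∷_; [])
open import Data.Maybe.Base using (map)
import Data.Nat.Base as ℕ
open ℕ using (ℕ; zero; suc)
import Data.Nat.Properties as ℕ
open import Data.Product using (Σ-syntax; ∃-syntax; _×_; _,_; proj₁; proj₂)
open import Data.Sum.Base using (inj₁; inj₂)
open import Data.Vec.Base using ([]; _∷_; lookup; tabulate)
import Data.Vec.Functional as Vector
open Vector using (Vector)
import Data.Vec.Properties as Vec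
open import Function.Base using (_∘_)
open import Relation.Binary.Bundles using (DecTotalOrder)
import Relation.Binary.PropositionalEquality as ≡
open ≡ using (_≡_)
import Relation.Binary.Reasoning.PartialOrder as PartialOrderReasoning
open import Relation.Nullary using (¬_; Dec; does; yes; no; contradiction)
open import Relation.Nullary.Decidable using (dec⇒maybe; dec-true)

-- Ordered field arithmetic

-- The score is sensitive because i is drawn without regard to ν whereas j favours heavy elements.
-- Symmetrised in i and j, its excess over 1/2 is the sum of (ν i - ν j)² / (ν i + ν j) over all
-- pairs, divided by 4n. This is scale free, so no power of n enters, but quadratic, so ε² is the
-- natural advantage and ε⁻⁴ the resulting cost. For the same reason a pointwise deviation of order
-- ε / n costs only a small multiple of ε². The obstacle is to extract ε² from this excess: the
-- denominators vary with i and j, and the distance is an ℓ1 distance to μ, not to the uniform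
-- distribution. Bounding each quotient by a line makes every sum linear in ν, and letting the slope
-- depend on j lets a linear term collect the ℓ1 distance, at a price of order ε². Denominators may
-- also vanish; hence conditional probabilities enter through equations that are multiplied out.

module OrderedField (R : RealField) where
  open RealFacts R
  module O = DecTotalOrder decTotalOrder
  module C = CommutativeRing commutativeRing
  open MultProperties C.semiring using (×-homo-+; ×1-homo-*)
  open RingProperties C.ring
    using (-‿involutive; -0#≈0#; -‿distribˡ-*; -‿distribʳ-*; -‿+-comm)
  open PartialOrderReasoning O.poset

  -- Integers serve as coefficients of the ring solver: their equality test evaluates, unlike that
  -- of the abstract field, so normal forms are compared by computation.
  fromℤ : ℤ → ℝ
  fromℤ (+ n)    = fromℕ n
  fromℤ -[1+ n ] = - fromℕ (suc n)

  private
    cancel-1+ : ∀ x y → x - y ≈ (1# + x) - (1# + y)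
    cancel-1+ x y = begin-equality
      x - y                     ≈⟨ C.+-congʳ (C.+-identityʳ x) ⟨
      (x + 0#) - y              ≈⟨ C.+-congʳ (C.+-congˡ (C.-‿inverseʳ 1#)) ⟨
      (x + (1# - 1#)) - y       ≈⟨ C.+-congʳ (C.+-assoc x 1# (- 1#)) ⟨
      ((x + 1#) - 1#) - y       ≈⟨ C.+-assoc _ _ _ ⟩
      (x + 1#) + (- 1# - y)     ≈⟨ C.+-cong (C.+-comm x 1#) (-‿+-comm 1# y) ⟩
      (1# + x) - (1# + y)       ∎

    fromℤ-⊖ : ∀ m n → fromℤ (m ℤ.⊖ n) ≈ fromℕ m - fromℕ n
    fromℤ-⊖ zero    zero    = C.sym (C.-‿inverseʳ 0#)
    fromℤ-⊖ zero    (suc n) = C.sym (C.+-identityˡ _)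
    fromℤ-⊖ (suc m) zero    = C.sym (C.trans (C.+-congˡ -0#≈0#) (C.+-identityʳ _))
    fromℤ-⊖ (suc m) (suc n) = begin-equality
      fromℤ (suc m ℤ.⊖ suc n)       ≡⟨ ≡.cong fromℤ (ℤ.[1+m]⊖[1+n]≡m⊖n m n) ⟩
      fromℤ (m ℤ.⊖ n)               ≈⟨ fromℤ-⊖ m n ⟩
      fromℕ m - fromℕ n             ≈⟨ cancel-1+ _ _ ⟩
      fromℕ (suc m) - fromℕ (suc n) ∎

    fromℤ-+ : ∀ i j → fromℤ (i ℤ.+ j) ≈ fromℤ i + fromℤ j
    fromℤ-+ (+ m)    (+ n)    = ×-homo-+ 1# m n
    fromℤ-+ (+ m)    -[1+ n ] = fromℤ-⊖ m (suc n)
    fromℤ-+ -[1+ m ] (+ n)    = C.trans (fromℤ-⊖ n (suc m)) (C.+-comm _ _)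
    fromℤ-+ -[1+ m ] -[1+ n ] = begin-equality
      - fromℕ (suc (suc (m ℕ.+ n)))      ≡⟨ ≡.cong (λ k → - fromℕ (suc k)) (+-suc m n) ⟨
      - fromℕ (suc m ℕ.+ suc n)          ≈⟨ C.-‿cong (×-homo-+ 1# (suc m) (suc n)) ⟩
      - (fromℕ (suc m) + fromℕ (suc n))  ≈⟨ -‿+-comm _ _ ⟨
      - fromℕ (suc m) - fromℕ (suc n)    ∎
      where open import Data.Nat.Properties using (+-suc)

    fromℤ-neg : ∀ i → fromℤ (ℤ.- i) ≈ - fromℤ i
    fromℤ-neg (+ zero)  = C.sym -0#≈0#
    fromℤ-neg (+ suc n) = C.refl
    fromℤ-neg -[1+ n ]  = C.sym (-‿involutive _)

    fromℤ-*⁺ : ∀ m j → fromℤ (+ m ℤ.* j) ≈ fromℕ m * fromℤ j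
    fromℤ-*⁺ m (+ n) = C.trans (C.reflexive (≡.cong fromℤ (≡.sym (ℤ.pos-* m n))))
                               (×1-homo-* m n)
    fromℤ-*⁺ m -[1+ n ] = begin-equality
      fromℤ (+ m ℤ.* -[1+ n ])        ≡⟨ ≡.cong fromℤ (ℤ.neg-distribʳ-* (+ m) (+ suc n)) ⟨
      fromℤ (ℤ.- (+ m ℤ.* + suc n))   ≈⟨ fromℤ-neg (+ m ℤ.* + suc n) ⟩
      - fromℤ (+ m ℤ.* + suc n)       ≈⟨ C.-‿cong (fromℤ-*⁺ m (+ suc n)) ⟩
      - (fromℕ m * fromℕ (suc n))     ≈⟨ -‿distribʳ-* _ _ ⟩
      fromℕ m * - fromℕ (suc n)       ∎

    fromℤ-* : ∀ i j → fromℤ (i ℤ.* j) ≈ fromℤ i * fromℤ j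
    fromℤ-* (+ m)    j = fromℤ-*⁺ m j
    fromℤ-* -[1+ m ] j = begin-equality
      fromℤ (-[1+ m ] ℤ.* j)      ≡⟨ ≡.cong fromℤ (ℤ.neg-distribˡ-* (+ suc m) j) ⟨
      fromℤ (ℤ.- (+ suc m ℤ.* j)) ≈⟨ fromℤ-neg (+ suc m ℤ.* j) ⟩
      - fromℤ (+ suc m ℤ.* j)     ≈⟨ C.-‿cong (fromℤ-*⁺ (suc m) j) ⟩
      - (fromℕ (suc m) * fromℤ j) ≈⟨ -‿distribˡ-* _ _ ⟩
      - fromℕ (suc m) * fromℤ j   ∎

    almostCommutativeRing : AlmostCommutativeRing _ _
    almostCommutativeRing = fromCommutativeRing commutativeRing

    fromℤ-morphism : ℤ.+-*-rawRing -Raw-AlmostCommutative⟶ almostCommutativeRing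
    fromℤ-morphism = record
      { ⟦_⟧    = fromℤ
      ; +-homo = fromℤ-+
      ; *-homo = fromℤ-*
      ; -‿homo = fromℤ-neg
      ; 0-homo = C.refl
      ; 1-homo = C.+-identityʳ 1#
      }

  open RingSolver ℤ.+-*-rawRing almostCommutativeRing fromℤ-morphism
    (λ i j → map (C.reflexive ∘ ≡.cong fromℤ) (dec⇒maybe (i ℤ.≟ j)))
    public using (solve; Polynomial; con; _:+_; _:*_; _:-_; :-_; _:^_; _:=_)

  # : ∀ {n} → ℕ → Polynomial n
  # m = con (+ m)

  -- The constant con (+ 1) denotes 1# + 0#.
  :1 : ∀ {n} → Polynomial n
  :1 = # 0 :^ 0

  -- Inequalities are proved by exhibiting their difference z as a nonnegative
  -- combination of hypotheses; the ring solver then checks y ≈ x + z.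
  certify : ∀ {x y} z → 0# ≤ z → y ≈ x + z → x ≤ y
  certify {x} {y} z 0≤z y≈x+z = begin
    x      ≈⟨ C.+-identityˡ x ⟨
    0# + x ≤⟨ +-monoˡ-≤ x 0≤z ⟩
    z + x  ≈⟨ C.+-comm z x ⟩
    x + z  ≈⟨ y≈x+z ⟨
    y      ∎

  x≤y⇒0≤y-x : ∀ {x y} → x ≤ y → 0# ≤ y - x
  x≤y⇒0≤y-x {x} {y} x≤y = begin
    0#    ≈⟨ C.-‿inverseʳ x ⟨
    x - x ≤⟨ +-monoˡ-≤ (- x) x≤y ⟩
    y - x ∎

  -- Feeds a hypothesis x ≈ y, with any multiplier, into a certificate.
  0≤c*[y-x] : ∀ c {x y} → x ≈ y → 0# ≤ c * (y - x)
  0≤c*[y-x] c {x} {y} x≈y = O.reflexive (C.sym (C.trans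
    (C.*-congˡ (C.trans (C.+-congˡ (C.-‿cong x≈y)) (C.-‿inverseʳ y))) (C.zeroʳ c)))

  +-nonNeg : ∀ {x y} → 0# ≤ x → 0# ≤ y → 0# ≤ x + y
  +-nonNeg {x} {y} 0≤x 0≤y = O.trans 0≤x (certify y 0≤y C.refl)

  +-mono-≤ : ∀ {w x y z} → w ≤ x → y ≤ z → w + y ≤ x + z
  +-mono-≤ {w} {x} {y} {z} w≤x y≤z = certify _ (+-nonNeg (x≤y⇒0≤y-x w≤x) (x≤y⇒0≤y-x y≤z))
    (solve 4 (λ w x y z → x :+ z := w :+ y :+ (x :- w :+ (z :- y))) C.refl w x y z)

  *-monoˡ-≤ : ∀ z {x y} → 0# ≤ z → x ≤ y → z * x ≤ z * y
  *-monoˡ-≤ z {x} {y} 0≤z x≤y = certify _ (*-nonNeg 0≤z (x≤y⇒0≤y-x x≤y))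
    (solve 3 (λ x y z → z :* y := z :* x :+ z :* (y :- x)) C.refl x y z)

  *-monoʳ-≤ : ∀ z {x y} → 0# ≤ z → x ≤ y → x * z ≤ y * z
  *-monoʳ-≤ z {x} {y} 0≤z x≤y = certify _ (*-nonNeg (x≤y⇒0≤y-x x≤y) 0≤z)
    (solve 3 (λ x y z → y :* z := x :* z :+ (y :- x) :* z) C.refl x y z)

  *-mono-≤ : ∀ {w x y z} → 0# ≤ y → 0# ≤ x → w ≤ x → y ≤ z → w * y ≤ x * z
  *-mono-≤ {x = x} {y} 0≤y 0≤x w≤x y≤z =
    O.trans (*-monoʳ-≤ y 0≤y w≤x) (*-monoˡ-≤ x 0≤x y≤z)

  ≰⇒≥ : ∀ {x y} → ¬ (x ≤ y) → y ≤ x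
  ≰⇒≥ {x} {y} x≰y with O.total x y
  ... | inj₁ x≤y = contradiction x≤y x≰y
  ... | inj₂ y≤x = y≤x

  x²-nonNeg : ∀ x → 0# ≤ x * x
  x²-nonNeg x with O.total 0# x
  ... | inj₁ 0≤x = *-nonNeg 0≤x 0≤x
  ... | inj₂ x≤0 = O.trans (*-nonNeg (x≤y⇒0≤y-x x≤0) (x≤y⇒0≤y-x x≤0))
    (O.reflexive (solve 1 (λ x → (# 0 :- x) :* (# 0 :- x) := x :* x) C.refl x))

  0≤1 : 0# ≤ 1#
  0≤1 = O.trans (x²-nonNeg 1#) (O.reflexive (C.*-identityˡ 1#))

  fromℕ-nonNeg : ∀ n → 0# ≤ fromℕ n
  fromℕ-nonNeg zero    = O.refl
  fromℕ-nonNeg (suc n) = +-nonNeg 0≤1 (fromℕ-nonNeg n)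

  fromℕ-mono : ∀ {m n} → m ℕ.≤ n → fromℕ m ≤ fromℕ n
  fromℕ-mono {n = n} ℕ.z≤n   = fromℕ-nonNeg n
  fromℕ-mono (ℕ.s≤s m≤n)     = +-mono-≤ O.refl (fromℕ-mono m≤n)

  1≰0 : ¬ (1# ≤ 0#)
  1≰0 1≤0 = 0≉1 (O.antisym 0≤1 1≤0)

  1≤fromℕ[1+n] : ∀ n → 1# ≤ fromℕ (suc n)
  1≤fromℕ[1+n] n = certify (fromℕ n) (fromℕ-nonNeg n) C.refl

  1≤x⇒0<x : ∀ {x} → 1# ≤ x → 0# < x
  1≤x⇒0<x 1≤x = O.trans 0≤1 1≤x , λ 0≈x → 1≰0 (O.trans 1≤x (O.reflexive (C.sym 0≈x)))

  0<fromℕ[1+n] : ∀ n → 0# < fromℕ (suc n)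
  0<fromℕ[1+n] n = 1≤x⇒0<x (1≤fromℕ[1+n] n)

  0<x≤y⇒0<y : ∀ {x y} → 0# < x → x ≤ y → 0# < y
  0<x≤y⇒0<y (0≤x , 0≉x) x≤y = O.trans 0≤x x≤y ,
    λ 0≈y → 0≉x (O.antisym 0≤x (O.trans x≤y (O.reflexive (C.sym 0≈y))))

  fromℕ-* : ∀ m n → fromℕ (m ℕ.* n) ≈ fromℕ m * fromℕ n
  fromℕ-* = ×1-homo-*

  ⁻¹-inverseʳ⁺ : ∀ {x} → 0# < x → x * x ⁻¹ ≈ 1#
  ⁻¹-inverseʳ⁺ (_ , 0≉x) = ⁻¹-inverseʳ (0≉x ∘ C.sym)

  d*[x*d⁻¹]≈x : ∀ {d} x → 0# < d → d * (x * d ⁻¹) ≈ x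
  d*[x*d⁻¹]≈x {d} x 0<d = begin-equality
    d * (x * d ⁻¹) ≈⟨ solve 3 (λ d x i → d :* (x :* i) := x :* (d :* i)) C.refl d x (d ⁻¹) ⟩
    x * (d * d ⁻¹) ≈⟨ C.*-congˡ (⁻¹-inverseʳ⁺ 0<d) ⟩
    x * 1#         ≈⟨ C.*-identityʳ x ⟩
    x              ∎

  *-cancelˡ-≤ : ∀ z {x y} → 0# < z → z * x ≤ z * y → x ≤ y
  *-cancelˡ-≤ z {x} {y} 0<z zx≤zy = begin
    x              ≈⟨ d*[x*d⁻¹]≈x x 0<z ⟨
    z * (x * z ⁻¹) ≈⟨ C.*-assoc z x (z ⁻¹) ⟨
    z * x * z ⁻¹   ≤⟨ *-monoʳ-≤ (z ⁻¹) (proj₁ (⁻¹-pos 0<z)) zx≤zy ⟩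
    z * y * z ⁻¹   ≈⟨ C.*-assoc z y (z ⁻¹) ⟩
    z * (y * z ⁻¹) ≈⟨ d*[x*d⁻¹]≈x y 0<z ⟩
    y              ∎

  *-pos : ∀ {x y} → 0# < x → 0# < y → 0# < x * y
  *-pos {x} {y} 0<x (0≤y , 0≉y) = *-nonNeg (proj₁ 0<x) 0≤y , λ 0≈xy → 0≉y (O.antisym 0≤y
    (*-cancelˡ-≤ x 0<x (O.reflexive (C.trans (C.sym 0≈xy) (C.sym (C.zeroʳ x))))))

  ^-nonNeg : ∀ {x} n → 0# ≤ x → 0# ≤ x ^ n
  ^-nonNeg zero    0≤x = 0≤1
  ^-nonNeg (suc n) 0≤x = *-nonNeg 0≤x (^-nonNeg n 0≤x)

  ^≤1 : ∀ {x} n → 0# ≤ x → x ≤ 1# → x ^ n ≤ 1#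
  ^≤1     zero    0≤x x≤1 = O.refl
  ^≤1 {x} (suc n) 0≤x x≤1 = O.trans (*-mono-≤ (^-nonNeg n 0≤x) 0≤1 x≤1 (^≤1 n 0≤x x≤1))
    (O.reflexive (C.*-identityˡ 1#))


-- Acceptance probabilities

module Verdicts (R : RealField) where
  open Testing R
  open OrderedField R
  open SumProperties C.+-commutativeMonoid public
    using (sum-cong-≋; ∑-distrib-+; ∑-comm)
  open SemiringSumProperties C.semiring public using (*-distribˡ-sum; *-distribʳ-sum)
  open PartialOrderReasoning O.poset

  private variable
    n q r : ℕ

  -- Finite sums

  sum-mono-≤ : {f g : Vector ℝ n} → (∀ i → f i ≤ g i) → sum f ≤ sum g
  sum-mono-≤ {zero}  f≤g = O.refl
  sum-mono-≤ {suc n} f≤g = +-mono-≤ (f≤g Fin.zero) (sum-mono-≤ (f≤g ∘ Fin.suc))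

  sum-nonNeg : {f : Vector ℝ n} → (∀ i → 0# ≤ f i) → 0# ≤ sum f
  sum-nonNeg {zero}  0≤f = O.refl
  sum-nonNeg {suc n} 0≤f = +-nonNeg (0≤f Fin.zero) (sum-nonNeg (0≤f ∘ Fin.suc))

  sum-zero : {f : Vector ℝ n} → (∀ i → f i ≈ 0#) → sum f ≈ 0#
  sum-zero {zero}  f≈0 = C.refl
  sum-zero {suc n} f≈0 = C.trans (C.+-cong (f≈0 Fin.zero) (sum-zero (f≈0 ∘ Fin.suc))) (C.+-identityˡ 0#)

  sum-const : ∀ n c → sum {n} (λ _ → c) ≈ fromℕ n * c
  sum-const zero    c = C.sym (C.zeroˡ c)
  sum-const (suc n) c = C.trans (C.+-congˡ (sum-const n c))
    (solve 2 (λ n c → c :+ n :* c := (:1 :+ n) :* c) C.refl (fromℕ n) c)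

  sum-δ : (f : Vector ℝ n) (j : Fin n) →
          sum (λ l → if does (l Fin.≟ j) then f l else 0#) ≈ f j
  sum-δ {suc n} f Fin.zero    = C.trans (C.+-congˡ (sum-zero {n} (λ _ → C.refl))) (C.+-identityʳ _)
  sum-δ {suc n} f (Fin.suc j) = C.trans (C.+-identityˡ _) (sum-δ (f ∘ Fin.suc) j)

  sum-toℕ-+ : ∀ m l (f : ℕ → ℝ) →
    sum {m ℕ.+ l} (f ∘ toℕ) ≈ sum {m} (f ∘ toℕ) + sum {l} (λ i → f (m ℕ.+ toℕ i))
  sum-toℕ-+ zero    l f = C.sym (C.+-identityˡ _)
  sum-toℕ-+ (suc m) l f = C.trans (C.+-congˡ (sum-toℕ-+ m l (f ∘ suc))) (C.sym (C.+-assoc _ _ _))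

  does-∈? : (j : Fin n) (A : Subset n) → does (j ∈? A) ≡ lookup A j
  does-∈? Fin.zero    (true  ∷ A) = ≡.refl
  does-∈? Fin.zero    (false ∷ A) = ≡.refl
  does-∈? (Fin.suc j) (_ ∷ A) = does-∈? j A

  sum-∈ : (A : Subset n) (c : ℝ) →
          sum (λ j → if does (j ∈? A) then c else 0#) ≈ fromℕ ∣ A ∣ * c
  sum-∈ []          c = C.sym (C.zeroˡ c)
  sum-∈ (true  ∷ A) c = C.trans (C.+-congˡ (sum-∈ A c))
    (solve 2 (λ n c → c :+ n :* c := (:1 :+ n) :* c) C.refl (fromℕ ∣ A ∣) c)
  sum-∈ (false ∷ A) c = C.trans (C.+-identityˡ _) (sum-∈ A c)

  0<∣A∣ : {A : Subset n} → Nonempty A → 0# < fromℕ ∣ A ∣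
  0<∣A∣ {A = true  ∷ A} _                     = 0<fromℕ[1+n] ∣ A ∣
  0<∣A∣ {A = false ∷ A} (Fin.suc j , j∈A) = 0<∣A∣ (j , drop-there j∈A)

  if-nonNeg : ∀ b {x} → 0# ≤ x → 0# ≤ (if b then x else 0#)
  if-nonNeg true  0≤x = 0≤x
  if-nonNeg false 0≤x = O.refl

  -- Conditional sampling

  module _ (ν : Distribution n) where

    mass-nonNeg : ∀ A → 0# ≤ mass ν A
    mass-nonNeg A = sum-nonNeg λ i → if-nonNeg (does (i ∈? A)) (pmf-nonNeg ν i)

    pmf≤mass : ∀ {A j} → j ∈ A → pmf ν j ≤ mass ν A
    pmf≤mass {A} {j} j∈A = O.trans (O.reflexive (C.sym (sum-δ (pmf ν) j))) (sum-mono-≤ lemma)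
      where
      lemma : ∀ l → (if does (l Fin.≟ j) then pmf ν l else 0#) ≤
                    (if does (l ∈? A) then pmf ν l else 0#)
      lemma l with l Fin.≟ j
      ... | no _       = if-nonNeg (does (l ∈? A)) (pmf-nonNeg ν l)
      ... | yes ≡.refl = O.reflexive (C.reflexive
        (≡.cong (λ b → if b then pmf ν l else 0#) (≡.sym (dec-true (l ∈? A) j∈A))))

    conditional-nonNeg : ∀ {A} → Nonempty A → ∀ j → 0# ≤ conditional ν A j
    conditional-nonNeg {A} ne j with does (j ∈? A)
    ... | false = O.refl
    ... | true with mass ν A ≟ 0#
    ...   | yes _ = proj₁ (⁻¹-pos (0<∣A∣ ne))
    ...   | no M≉0 = *-nonNeg (pmf-nonNeg ν j) (proj₁ (⁻¹-pos (mass-nonNeg A , M≉0 ∘ C.sym)))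

    conditional-sum : ∀ {A} → Nonempty A → sum (conditional ν A) ≈ 1#
    conditional-sum {A} ne with mass ν A ≟ 0#
    ... | yes _   = C.trans (sum-∈ A _) (⁻¹-inverseʳ⁺ (0<∣A∣ ne))
    ... | no M≉0 = begin-equality
      sum (λ j → if does (j ∈? A) then pmf ν j * M⁻¹ else 0#)
        ≈⟨ sum-cong-≋ (λ j → lemma j (does (j ∈? A))) ⟩
      sum (λ j → (if does (j ∈? A) then pmf ν j else 0#) * M⁻¹)
        ≈⟨ *-distribʳ-sum M⁻¹ (λ j → if does (j ∈? A) then pmf ν j else 0#) ⟨
      mass ν A * M⁻¹
        ≈⟨ ⁻¹-inverseʳ M≉0 ⟩
      1# ∎
      where
      M⁻¹ = mass ν A ⁻¹
      lemma : ∀ j b → (if b then pmf ν j * M⁻¹ else 0#) ≈ (if b then pmf ν j else 0#) * M⁻¹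
      lemma j true  = C.refl
      lemma j false = C.sym (C.zeroˡ M⁻¹)

    -- Multiplying out the denominator covers the uniform default too: if A has mass zero then so
    -- has its element j, and both sides vanish.
    mass*conditional : ∀ A j → j ∈ A → mass ν A * conditional ν A j ≈ pmf ν j
    mass*conditional A j j∈A with j ∈? A
    ... | no j∉A = contradiction j∈A j∉A
    ... | yes _ with mass ν A ≟ 0#
    ...   | no M≉0 = d*[x*d⁻¹]≈x (pmf ν j) (mass-nonNeg A , M≉0 ∘ C.sym)
    ...   | yes M≈0 = C.trans (C.trans (C.*-congʳ M≈0) (C.zeroˡ _)) 
      (O.antisym (pmf-nonNeg ν j) (O.trans (pmf≤mass j∈A) (O.reflexive M≈0)))

    mass-⊤ : mass ν ⊤ ≈ 1#
    mass-⊤ = C.trans (sum-cong-≋ λ j → C.reflexive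
      (≡.cong (λ b → if b then pmf ν j else 0#) (dec-true (j ∈? ⊤) ∈⊤))) (pmf-sum ν)

    conditional-⊤ : ∀ j → conditional ν ⊤ j ≈ pmf ν j
    conditional-⊤ j = C.trans (C.sym (C.*-identityˡ _))
      (C.trans (C.*-congʳ (C.sym mass-⊤)) (mass*conditional ⊤ j ∈⊤))

  pair : Fin n → Fin n → Subset n
  pair i j = tabulate (λ l → does (l Fin.≟ i) ∨ does (l Fin.≟ j))

  ∈-pair : (i j : Fin n) → j ∈ pair i j
  ∈-pair i j = Vec.lookup⇒[]= j (pair i j) (≡.trans (Vec.lookup∘tabulate _ j)
    (≡.trans (≡.cong (does (j Fin.≟ i) ∨_) (dec-true (j Fin.≟ j) ≡.refl)) (∨-zeroʳ _)))

  mass-pair : ∀ (ν : Distribution n) {i j} → ¬ (i ≡ j) → mass ν (pair i j) ≈ pmf ν i + pmf ν j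
  mass-pair {n} ν {i} {j} i≢j = begin-equality
    mass ν (pair i j)     ≈⟨ sum-cong-≋ split ⟩
    sum (λ l → δ i l + δ j l) ≈⟨ ∑-distrib-+ (δ i) (δ j) ⟩
    sum (δ i) + sum (δ j) ≈⟨ C.+-cong (sum-δ (pmf ν) i) (sum-δ (pmf ν) j) ⟩
    pmf ν i + pmf ν j     ∎
    where
    δ : Fin n → Fin n → ℝ
    δ i l = if does (l Fin.≟ i) then pmf ν l else 0#
    split : ∀ l → (if does (l ∈? pair i j) then pmf ν l else 0#) ≈ δ i l + δ j l
    split l rewrite does-∈? l (pair i j)
                  | Vec.lookup∘tabulate (λ l → does (l Fin.≟ i) ∨ does (l Fin.≟ j)) l
      with l Fin.≟ i | l Fin.≟ j
    ... | yes ≡.refl | yes ≡.refl = contradiction ≡.refl i≢j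
    ... | yes _      | no _       = C.sym (C.+-identityʳ _)
    ... | no _       | yes _      = C.sym (C.+-identityˡ _)
    ... | no _       | no _       = C.sym (C.+-identityˡ _)

  -- The expected payoff of the verdict. Acceptance, rejection and exponential moments are
  -- instances, and sequential composition becomes a substitution of payoffs.
  value : (Bool → ℝ) → Algorithm n q → Distribution n → ℝ
  value g accept        ν = g true
  value g reject        ν = g false
  value g (toss k)      ν = fromℕ 2 ⁻¹ * (value g (k true) ν + value g (k false) ν)
  value g (query A _ k) ν = sum (λ j → conditional ν A j * value g (k j) ν)

  half+half : ∀ x → fromℕ 2 ⁻¹ * (x + x) ≈ x
  half+half x = begin-equality
    fromℕ 2 ⁻¹ * (x + x)     ≈⟨ solve 2 (λ h x → h :* (x :+ x) := (# 2 :* h) :* x) C.refl (fromℕ 2 ⁻¹) x ⟩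
    (fromℕ 2 * fromℕ 2 ⁻¹) * x ≈⟨ C.*-congʳ (⁻¹-inverseʳ⁺ (0<fromℕ[1+n] 1)) ⟩
    1# * x                   ≈⟨ C.*-identityˡ x ⟩
    x                        ∎

  value-linear : ∀ g (T : Algorithm n q) ν →
    value g T ν ≈ g true * Pr[ T accepts ν ] + g false * Pr[ T rejects ν ]
  value-linear g accept ν = solve 2 (λ a b → a := a :* :1 :+ b :* # 0) C.refl (g true) (g false)
  value-linear g reject ν = solve 2 (λ a b → b := a :* # 0 :+ b :* :1) C.refl (g true) (g false)
  value-linear g (toss k) ν = C.trans
    (C.*-congˡ (C.+-cong (value-linear g (k true) ν) (value-linear g (k false) ν)))
    (solve 7 (λ a b h p q r s → h :* (a :* p :+ b :* q :+ (a :* r :+ b :* s)) :=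
       a :* (h :* (p :+ r)) :+ b :* (h :* (q :+ s))) C.refl
       (g true) (g false) (fromℕ 2 ⁻¹)
       Pr[ k true accepts ν ] Pr[ k true rejects ν ] Pr[ k false accepts ν ] Pr[ k false rejects ν ])
  value-linear g (query A ne k) ν = begin-equality
    sum (λ j → γ j * value g (k j) ν)
      ≈⟨ sum-cong-≋ (λ j → C.trans (C.*-congˡ (value-linear g (k j) ν))
           (solve 5 (λ c a b p q → c :* (a :* p :+ b :* q) := a :* (c :* p) :+ b :* (c :* q))
             C.refl (γ j) (g true) (g false) Pr[ k j accepts ν ] Pr[ k j rejects ν ])) ⟩
    sum (λ j → g true * acc j + g false * rej j)
      ≈⟨ ∑-distrib-+ (λ j → g true * acc j) (λ j → g false * rej j) ⟩
    sum (λ j → g true * acc j) + sum (λ j → g false * rej j)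
      ≈⟨ C.+-cong (*-distribˡ-sum (g true) acc) (*-distribˡ-sum (g false) rej) ⟨
    g true * sum acc + g false * sum rej ∎
    where
    γ = conditional ν A
    acc rej : Fin _ → ℝ
    acc j = γ j * Pr[ k j accepts ν ]
    rej j = γ j * Pr[ k j rejects ν ]

  accepts≈value : (T : Algorithm n q) → ∀ ν →
    Pr[ T accepts ν ] ≈ value (if_then 1# else 0#) T ν
  accepts≈value T ν = C.sym (C.trans (value-linear (if_then 1# else 0#) T ν)
    (solve 2 (λ p q → :1 :* p :+ # 0 :* q := p) C.refl Pr[ T accepts ν ] Pr[ T rejects ν ]))

  rejects≈value : (T : Algorithm n q) → ∀ ν →
    Pr[ T rejects ν ] ≈ value (if_then 0# else 1#) T ν
  rejects≈value T ν = C.sym (C.trans (value-linear (if_then 0# else 1#) T ν)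
    (solve 2 (λ p q → # 0 :* p :+ :1 :* q := q) C.refl Pr[ T accepts ν ] Pr[ T rejects ν ]))

  value-mono-≤ : ∀ {g h} → (∀ b → g b ≤ h b) → (T : Algorithm n q) → ∀ ν → value g T ν ≤ value h T ν
  value-mono-≤ g≤h accept ν = g≤h true
  value-mono-≤ g≤h reject ν = g≤h false
  value-mono-≤ g≤h (toss k) ν = *-monoˡ-≤ _ (proj₁ (⁻¹-pos (0<fromℕ[1+n] 1)))
    (+-mono-≤ (value-mono-≤ g≤h (k true) ν) (value-mono-≤ g≤h (k false) ν))
  value-mono-≤ g≤h (query A ne k) ν = sum-mono-≤ λ j →
    *-monoˡ-≤ _ (conditional-nonNeg ν ne j) (value-mono-≤ g≤h (k j) ν)

  value-const : ∀ c (T : Algorithm n q) ν → value (λ _ → c) T ν ≈ c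
  value-const c accept ν = C.refl
  value-const c reject ν = C.refl
  value-const c (toss k) ν = C.trans
    (C.*-congˡ (C.+-cong (value-const c (k true) ν) (value-const c (k false) ν))) (half+half c)
  value-const c (query A ne k) ν = begin-equality
    sum (λ j → conditional ν A j * value (λ _ → c) (k j) ν)
      ≈⟨ sum-cong-≋ (λ j → C.*-congˡ (value-const c (k j) ν)) ⟩
    sum (λ j → conditional ν A j * c) ≈⟨ *-distribʳ-sum c (conditional ν A) ⟨
    sum (conditional ν A) * c ≈⟨ C.*-congʳ (conditional-sum ν ne) ⟩
    1# * c                    ≈⟨ C.*-identityˡ c ⟩
    c                         ∎

  accepts+rejects : (T : Algorithm n q) → ∀ ν → Pr[ T accepts ν ] + Pr[ T rejects ν ] ≈ 1#
  accepts+rejects T ν = begin-equality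
    Pr[ T accepts ν ] + Pr[ T rejects ν ]
      ≈⟨ solve 2 (λ p q → p :+ q := :1 :* p :+ :1 :* q) C.refl Pr[ T accepts ν ] Pr[ T rejects ν ] ⟩
    1# * Pr[ T accepts ν ] + 1# * Pr[ T rejects ν ] ≈⟨ value-linear (λ _ → 1#) T ν ⟨
    value (λ _ → 1#) T ν ≈⟨ value-const 1# T ν ⟩
    1# ∎

  value-nonNeg : ∀ {g} → (∀ b → 0# ≤ g b) → (T : Algorithm n q) → ∀ ν → 0# ≤ value g T ν
  value-nonNeg 0≤g T ν = O.trans (O.reflexive (C.sym (value-const 0# T ν))) (value-mono-≤ 0≤g T ν)

  accepts-nonNeg : (T : Algorithm n q) → ∀ ν → 0# ≤ Pr[ T accepts ν ]
  accepts-nonNeg T ν = O.trans (value-nonNeg (λ b → if-nonNeg b 0≤1) T ν)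
    (O.reflexive (C.sym (accepts≈value T ν)))

  rejects-nonNeg : (T : Algorithm n q) → ∀ ν → 0# ≤ Pr[ T rejects ν ]
  rejects-nonNeg T ν = O.trans (value-nonNeg (λ { true → O.refl ; false → 0≤1 }) T ν)
    (O.reflexive (C.sym (rejects≈value T ν)))

  -- Composition, and random indices from coins

  weaken : q ℕ.≤ r → Algorithm n q → Algorithm n r
  weaken q≤r         accept         = accept
  weaken q≤r         reject         = reject
  weaken q≤r         (toss k)       = toss (weaken q≤r ∘ k)
  weaken (ℕ.s≤s q≤r) (query A ne k) = query A ne (weaken q≤r ∘ k)

  value-weaken : ∀ g (q≤r : q ℕ.≤ r) (T : Algorithm n q) ν → value g (weaken q≤r T) ν ≈ value g T ν
  value-weaken g q≤r accept ν = C.refl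
  value-weaken g q≤r reject ν = C.refl
  value-weaken g q≤r (toss k) ν =
    C.*-congˡ (C.+-cong (value-weaken g q≤r (k true) ν) (value-weaken g q≤r (k false) ν))
  value-weaken g (ℕ.s≤s q≤r) (query A ne k) ν =
    sum-cong-≋ λ j → C.*-congˡ (value-weaken g q≤r (k j) ν)

  -- A branch of the first stage may stop with q samples unspent; `weaken` absorbs them.
  _>>=_ : Algorithm n q → (Bool → Algorithm n r) → Algorithm n (q ℕ.+ r)
  _>>=_ {q = q} {r = r} accept k = weaken (ℕ.m≤n+m r q) (k true)
  _>>=_ {q = q} {r = r} reject k = weaken (ℕ.m≤n+m r q) (k false)
  toss l       >>= k = toss λ b → l b >>= k
  query A ne l >>= k = query A ne λ j → l j >>= k

  value->>= : ∀ g (T : Algorithm n q) (k : Bool → Algorithm n r) ν →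
              value g (T >>= k) ν ≈ value (λ b → value g (k b) ν) T ν
  value->>= {q = q} {r = r} g accept k ν = value-weaken g (ℕ.m≤n+m r q) (k true) ν
  value->>= {q = q} {r = r} g reject k ν = value-weaken g (ℕ.m≤n+m r q) (k false) ν
  value->>= g (toss l) k ν =
    C.*-congˡ (C.+-cong (value->>= g (l true) k ν) (value->>= g (l false) k ν))
  value->>= g (query A ne l) k ν = sum-cong-≋ λ j → C.*-congˡ (value->>= g (l j) k ν)

  -- Reads a k-bit index, most significant bit first; `false` adds the place value of the bit.
  -- Indexing by natural numbers avoids casts between `Fin` types when the range is halved.
  tosses : ℕ → (ℕ → Algorithm n q) → Algorithm n q
  tosses zero    f = f 0
  tosses (suc k) f = toss λ b → tosses k (if b then f else f ∘ (2 ℕ.^ k ℕ.+_))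

  tosses-accepts : ∀ k (f : ℕ → Algorithm n q) ν →
    fromℕ (2 ℕ.^ k) * Pr[ tosses k f accepts ν ] ≈
    sum {2 ℕ.^ k} (λ i → Pr[ f (toℕ i) accepts ν ])
  tosses-accepts zero    f ν = solve 1 (λ p → # 1 :* p := p :+ # 0) C.refl Pr[ f 0 accepts ν ]
  tosses-accepts (suc k) f ν = begin-equality
    fromℕ (2 ℕ.* P) * (fromℕ 2 ⁻¹ * (p + p′))
      ≈⟨ C.*-congʳ (fromℕ-* 2 P) ⟩
    (fromℕ 2 * fromℕ P) * (fromℕ 2 ⁻¹ * (p + p′))
      ≈⟨ solve 4 (λ P h p p′ → (# 2 :* P) :* (h :* (p :+ p′)) :=
           h :* ((P :* p :+ P :* p′) :+ (P :* p :+ P :* p′))) C.refl (fromℕ P) (fromℕ 2 ⁻¹) p p′ ⟩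
    fromℕ 2 ⁻¹ * ((fromℕ P * p + fromℕ P * p′) + (fromℕ P * p + fromℕ P * p′))
      ≈⟨ half+half _ ⟩
    fromℕ P * p + fromℕ P * p′
      ≈⟨ C.+-cong (tosses-accepts k f ν) (tosses-accepts k (f ∘ (P ℕ.+_)) ν) ⟩
    sum {P} (s ∘ toℕ) + sum {P} (λ i → s (P ℕ.+ toℕ i))
      ≈⟨ sum-toℕ-+ P P s ⟨
    sum {P ℕ.+ P} (s ∘ toℕ)
      ≡⟨ ≡.cong (λ m → sum {P ℕ.+ m} (s ∘ toℕ)) (ℕ.+-identityʳ P) ⟨
    sum {2 ℕ.* P} (s ∘ toℕ) ∎
    where
    P = 2 ℕ.^ k
    p = Pr[ tosses k f accepts ν ]
    p′ = Pr[ tosses k (f ∘ (P ℕ.+_)) accepts ν ]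
    s : ℕ → ℝ
    s i = Pr[ f i accepts ν ]

  pad : ∀ {A : Set} → Vector A n → A → ℕ → A
  pad {zero}  v d m       = d
  pad {suc n} v d zero    = v Fin.zero
  pad {suc n} v d (suc m) = pad (v ∘ Fin.suc) d m

  sum-pad : ∀ {A : Set} (h : A → ℝ) (v : Vector A n) {d} → h d ≈ 0# → ∀ {m} → n ℕ.≤ m →
            sum {m} (λ i → h (pad v d (toℕ i))) ≈ sum (h ∘ v)
  sum-pad {zero}  h v {d} hd≈0 {m} _ = sum-zero {m} {λ _ → h d} λ _ → hd≈0
  sum-pad {suc n} h v hd≈0 (ℕ.s≤s n≤m) = C.+-congˡ (sum-pad h (v ∘ Fin.suc) hd≈0 n≤m)

-- Amplification

module Amplification (R : RealField) where
  open Testing R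
  open OrderedField R
  open Verdicts R
  open ExpProperties C.semiring using (^-assocʳ)
  open CommutativeExpProperties C.commutativeSemiring using (^-distrib-*)
  open PartialOrderReasoning O.poset

  private variable
    n q : ℕ

  -- A second-order stand-in for exp, with weight y * weight (- y) ≥ 1.
  weight : ℝ → ℝ
  weight y = 1# + y + y * y

  weight-nonNeg : ∀ y → 0# ≤ weight y
  weight-nonNeg y = *-cancelˡ-≤ (fromℕ 2) (0<fromℕ[1+n] 1) (certify _
    (+-nonNeg 0≤1 (+-nonNeg (x²-nonNeg y) (x²-nonNeg (1# + y))))
    (solve 1 (λ y → # 2 :* (:1 :+ y :+ y :* y) :=
      # 2 :* # 0 :+ (:1 :+ (y :* y :+ (:1 :+ y) :* (:1 :+ y)))) C.refl y))

  1≤weight*weight- : ∀ y → 1# ≤ weight y * weight (- y)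
  1≤weight*weight- y = certify _ (+-nonNeg (x²-nonNeg y) (x²-nonNeg (y * y)))
    (solve 1 (λ y → (:1 :+ y :+ y :* y) :* (:1 :+ :- y :+ :- y :* :- y) :=
      :1 :+ (y :* y :+ y :* y :* (y :* y))) C.refl y)

  value-scale : ∀ c g (T : Algorithm n q) ν → value (λ b → c * g b) T ν ≈ c * value g T ν
  value-scale c g T ν = C.trans (value-linear (λ b → c * g b) T ν) (C.sym (C.trans
    (C.*-congˡ (value-linear g T ν))
    (solve 5 (λ c a b p r → c :* (a :* p :+ b :* r) := c :* a :* p :+ c :* b :* r) C.refl
      c (g true) (g false) Pr[ T accepts ν ] Pr[ T rejects ν ])))

  -- The weight w tracks Π weight (y b) over the verdicts b; the reciprocal
  -- direction is controlled by Π weight (- y b), without any division.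
  run : Algorithm n q → (Bool → ℝ) → ∀ m → ℝ → Algorithm n (m ℕ.* q)
  run B y zero    w = if does (1# ≤? w) then reject else accept
  run B y (suc m) w = B >>= λ b → run B y m (w * weight (y b))

  module _ (B : Algorithm n q) (y : Bool → ℝ) (ν : Distribution n) {a} (0≤a : 0# ≤ a) where

    private
      -- One round of the moment bound: whatever the past, the expected weight changes by a factor
      -- of at most a. Taking z to be y or its negation serves the two directions of error.
      step : ∀ g (z : Bool → ℝ) m (k : Bool → Algorithm n (m ℕ.* q)) {w} → 0# ≤ w →
             value (weight ∘ z) B ν ≤ a →
             (∀ b → value g (k b) ν ≤ w * weight (z b) * a ^ m) →
             value g (B >>= k) ν ≤ w * a ^ suc m
      step g z m k {w} 0≤w Ez≤a ih = begin
        value g (B >>= k) ν                      ≈⟨ value->>= g B k ν ⟩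
        value (λ b → value g (k b) ν) B ν        ≤⟨ value-mono-≤ ih B ν ⟩
        value (λ b → w * weight (z b) * a ^ m) B ν
          ≤⟨ value-mono-≤ (λ b → O.reflexive (solve 3 (λ w x c → w :* x :* c := w :* c :* x)
               C.refl w (weight (z b)) (a ^ m))) B ν ⟩
        value (λ b → w * a ^ m * weight (z b)) B ν ≈⟨ value-scale (w * a ^ m) (weight ∘ z) B ν ⟩
        w * a ^ m * value (weight ∘ z) B ν       ≤⟨ *-monoˡ-≤ _ (*-nonNeg 0≤w (^-nonNeg m 0≤a)) Ez≤a ⟩
        w * a ^ m * a
          ≈⟨ solve 3 (λ w c a → w :* c :* a := w :* (a :* c)) C.refl w (a ^ m) a ⟩
        w * (a * a ^ m)                          ∎

    -- Markov's inequality: rejection requires a final weight of at least 1, so its indicator is at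
    -- most that weight, whose expectation is bounded round by round.
    run-rejects : value (weight ∘ y) B ν ≤ a → ∀ m {w} → 0# ≤ w →
                  value (if_then 0# else 1#) (run B y m w) ν ≤ w * a ^ m
    run-rejects E≤a zero    {w} 0≤w with 1# ≤? w
    ... | yes 1≤w = O.trans 1≤w (O.reflexive (C.sym (C.*-identityʳ w)))
    ... | no _    = O.trans 0≤w (O.reflexive (C.sym (C.*-identityʳ w)))
    run-rejects E≤a (suc m) {w} 0≤w = step _ y m (λ b → run B y m (w * weight (y b))) 0≤w E≤a λ b →
      run-rejects E≤a m (*-nonNeg 0≤w (weight-nonNeg (y b)))

    -- Here v is a ghost weight, absent from the algorithm and built from the negated exponents.
    -- Acceptance leaves w at most 1, so 1 ≤ w * v forces v to be at least 1, and Markov's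
    -- inequality applies to v.
    run-accepts : value (weight ∘ -_ ∘ y) B ν ≤ a → ∀ m {w v} → 0# ≤ w → 0# ≤ v → 1# ≤ w * v →
                  value (if_then 1# else 0#) (run B y m w) ν ≤ v * a ^ m
    run-accepts E≤a zero    {w} {v} 0≤w 0≤v 1≤wv with 1# ≤? w
    ... | yes _  = O.trans 0≤v (O.reflexive (C.sym (C.*-identityʳ v)))
    ... | no 1≰w = begin
      1#     ≤⟨ 1≤wv ⟩
      w * v  ≤⟨ *-monoʳ-≤ v 0≤v (≰⇒≥ 1≰w) ⟩
      1# * v ≈⟨ C.*-comm 1# v ⟩
      v * 1# ∎
    run-accepts E≤a (suc m) {w} {v} 0≤w 0≤v 1≤wv =
      step _ (-_ ∘ y) m (λ b → run B y m (w * weight (y b))) 0≤v E≤a λ b →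
      run-accepts E≤a m (*-nonNeg 0≤w (weight-nonNeg (y b))) (*-nonNeg 0≤v (weight-nonNeg (- y b)))
        (begin
          1#          ≈⟨ C.*-identityˡ 1# ⟨
          1# * 1#     ≤⟨ *-mono-≤ 0≤1 (O.trans 0≤1 1≤wv) 1≤wv (1≤weight*weight- (y b)) ⟩
          w * v * (weight (y b) * weight (- y b))
            ≈⟨ solve 4 (λ w v x x′ → w :* v :* (x :* x′) := w :* x :* (v :* x′)) C.refl
                 w v (weight (y b)) (weight (- y b)) ⟩
          w * weight (y b) * (v * weight (- y b)) ∎)

  module Threshold (t s : ℝ) (0≤t : 0# ≤ t) (t≤1 : t ≤ 1#)
                   (0≤s : 0# ≤ s) (0≤1-s² : 0# ≤ 1# - s * s) where

    deviation : Bool → ℝ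
    deviation true  = s * (1# - t)
    deviation false = s * (0# - t)

    -- The verdict is inverted: frequent acceptance by B means a high score, hence a distribution
    -- far from μ, and drives the weight up to the rejecting side.
    amplify : Algorithm n q → ∀ m → Algorithm n (m ℕ.* q)
    amplify B m = run B deviation m 1#

    module _ (B : Algorithm n q) (ν : Distribution n) where
      private
        p = Pr[ B accepts ν ]

        0≤1-t = x≤y⇒0≤y-x t≤1

        rejects≈1-p : Pr[ B rejects ν ] ≈ 1# - p
        rejects≈1-p = C.trans (solve 2 (λ p r → r := (p :+ r) :- p) C.refl p _)
          (C.+-congʳ (accepts+rejects B ν))

        0≤1-p : 0# ≤ 1# - p
        0≤1-p = O.trans (rejects-nonNeg B ν) (O.reflexive rejects≈1-p)

        value≈ : ∀ g → value g B ν ≈ g true * p + g false * (1# - p)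
        value≈ g = C.trans (value-linear g B ν) (C.+-congˡ (C.*-congˡ rejects≈1-p))

        -- A verdict, read as 0 or 1, differs from t by at most 1. The bracket is the amount by
        -- which the mean square of the difference falls short of 1.
        0≤slack : 0# ≤ s * s * (p * (t + t * (1# - t)) + (1# - p) * ((1# - t) + (1# - t) * t))
        0≤slack = *-nonNeg (x²-nonNeg s) (+-nonNeg
          (*-nonNeg (accepts-nonNeg B ν) (+-nonNeg 0≤t (*-nonNeg 0≤t 0≤1-t)))
          (*-nonNeg 0≤1-p (+-nonNeg 0≤1-t (*-nonNeg 0≤1-t 0≤t))))

      -- The mean weight is 1 + s (p - t) plus at most s². The margin 2 s makes the linear term at
      -- most -2 s², twice the size of the quadratic one, which leaves 1 - s².
      amplify-rejects : p + fromℕ 2 * s ≤ t → ∀ m → Pr[ amplify B m rejects ν ] ≤ (1# - s * s) ^ m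
      amplify-rejects p+2s≤t m = begin
        Pr[ amplify B m rejects ν ] ≈⟨ rejects≈value (amplify B m) ν ⟩
        value (if_then 0# else 1#) (amplify B m) ν ≤⟨ run-rejects B deviation ν 0≤1-s² E≤ m 0≤1 ⟩
        1# * (1# - s * s) ^ m ≈⟨ C.*-identityˡ _ ⟩
        (1# - s * s) ^ m ∎
        where
        E≤ : value (weight ∘ deviation) B ν ≤ 1# - s * s
        E≤ = O.trans (O.reflexive (value≈ (weight ∘ deviation))) (certify _
          (+-nonNeg (*-nonNeg 0≤s (x≤y⇒0≤y-x p+2s≤t)) 0≤slack)
          (solve 3 (λ p s t → let weight = λ y → :1 :+ y :+ y :* y in
            :1 :- s :* s := weight (s :* (:1 :- t)) :* p :+ weight (s :* (# 0 :- t)) :* (:1 :- p)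
              :+ (s :* (t :- (p :+ # 2 :* s)) :+
                  s :* s :* (p :* (t :+ t :* (:1 :- t)) :+ (:1 :- p) :* ((:1 :- t) :+ (:1 :- t) :* t))))
            C.refl p s t))

      amplify-accepts : t + fromℕ 2 * s ≤ p → ∀ m → Pr[ amplify B m accepts ν ] ≤ (1# - s * s) ^ m
      amplify-accepts t+2s≤p m = begin
        Pr[ amplify B m accepts ν ] ≈⟨ accepts≈value (amplify B m) ν ⟩
        value (if_then 1# else 0#) (amplify B m) ν
          ≤⟨ run-accepts B deviation ν 0≤1-s² E≤ m 0≤1 0≤1 (O.reflexive (C.sym (C.*-identityˡ 1#))) ⟩
        1# * (1# - s * s) ^ m ≈⟨ C.*-identityˡ _ ⟩
        (1# - s * s) ^ m ∎
        where
        E≤ : value (weight ∘ -_ ∘ deviation) B ν ≤ 1# - s * s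
        E≤ = O.trans (O.reflexive (value≈ (weight ∘ -_ ∘ deviation))) (certify _
          (+-nonNeg (*-nonNeg 0≤s (x≤y⇒0≤y-x t+2s≤p)) 0≤slack)
          (solve 3 (λ p s t → let weight = λ y → :1 :+ y :+ y :* y in
            :1 :- s :* s := weight (:- (s :* (:1 :- t))) :* p :+ weight (:- (s :* (# 0 :- t))) :* (:1 :- p)
              :+ (s :* (p :- (t :+ # 2 :* s)) :+
                  s :* s :* (p :* (t :+ t :* (:1 :- t)) :+ (:1 :- p) :* ((:1 :- t) :+ (:1 :- t) :* t))))
            C.refl p s t))

  -- The left side does not increase with m: the step from m to m + 1 loses exactly (1 - a)^m (m +
  -- 1) a².
  bernoulli : ∀ {a} → 0# ≤ a → 0# ≤ 1# - a → ∀ m → (1# - a) ^ m * (1# + fromℕ m * a) ≤ 1#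
  bernoulli {a} 0≤a 0≤1-a zero = O.reflexive (solve 1 (λ a → :1 :* (:1 :+ # 0 :* a) := :1) C.refl a)
  bernoulli {a} 0≤a 0≤1-a (suc m) = begin
    (1# - a) * c * (1# + fromℕ (suc m) * a)
      ≤⟨ certify _ (*-nonNeg (*-nonNeg (^-nonNeg m 0≤1-a) (fromℕ-nonNeg (suc m))) (x²-nonNeg a))
           (solve 3 (λ a c m → c :* (:1 :+ m :* a) :=
             (:1 :- a) :* c :* (:1 :+ (:1 :+ m) :* a) :+ c :* (:1 :+ m) :* (a :* a)) C.refl
             a c (fromℕ m)) ⟩
    c * (1# + fromℕ m * a) ≤⟨ bernoulli 0≤a 0≤1-a m ⟩
    1# ∎
    where c = (1# - a) ^ m

  -- As m a ≥ 1, `bernoulli` shows that each block of m rounds at least halves the error; k halvings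
  -- bring it down to δ.
  decay : ∀ {a δ} m k → 0# ≤ a → 0# ≤ 1# - a → 1# ≤ fromℕ m * a → 0# < δ → δ ⁻¹ ≤ fromℕ 2 ^ k →
          (1# - a) ^ (m ℕ.* k) ≤ δ
  decay {a} {δ} m k 0≤a 0≤1-a 1≤ma 0<δ δ⁻¹≤2^k = *-cancelˡ-≤ (δ ⁻¹) (⁻¹-pos 0<δ) (begin
    δ ⁻¹ * (1# - a) ^ (m ℕ.* k) ≤⟨ *-monoʳ-≤ _ (^-nonNeg (m ℕ.* k) 0≤1-a) δ⁻¹≤2^k ⟩
    fromℕ 2 ^ k * (1# - a) ^ (m ℕ.* k) ≈⟨ C.*-congˡ (^-assocʳ (1# - a) m k) ⟨
    fromℕ 2 ^ k * ((1# - a) ^ m) ^ k   ≈⟨ ^-distrib-* (fromℕ 2) ((1# - a) ^ m) k ⟨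
    (fromℕ 2 * (1# - a) ^ m) ^ k       ≤⟨ ^≤1 k (*-nonNeg (fromℕ-nonNeg 2) (^-nonNeg m 0≤1-a)) half ⟩
    1#         ≈⟨ ⁻¹-inverseʳ⁺ 0<δ ⟨
    δ * δ ⁻¹   ≈⟨ C.*-comm _ _ ⟩
    δ ⁻¹ * δ   ∎)
    where
    half : fromℕ 2 * (1# - a) ^ m ≤ 1#
    half = begin
      fromℕ 2 * (1# - a) ^ m ≤⟨ certify _ (*-nonNeg (^-nonNeg m 0≤1-a) (x≤y⇒0≤y-x 1≤ma))
        (solve 2 (λ c x → c :* (:1 :+ x) := # 2 :* c :+ c :* (x :- :1)) C.refl 
          ((1# - a) ^ m) (fromℕ m * a)) ⟩
      (1# - a) ^ m * (1# + fromℕ m * a) ≤⟨ bernoulli 0≤a 0≤1-a m ⟩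
      1# ∎

-- The two-sample test

module PairTest (R : RealField) where
  open Testing R
  open OrderedField R
  open Verdicts R
  open PartialOrderReasoning O.poset
  module ⊔ = Max O.totalOrder

  private variable
    n : ℕ

  -- For i ≡ j the formula ν j / (ν i + ν j) reads 1/2, hence the coin.
  pairTest : Fin n → Fin n → Algorithm n 1
  pairTest i j =
    if does (i Fin.≟ j)
    then toss (if_then accept else reject)
    else query (pair i j) (j , ∈-pair i j) (λ l → if does (l Fin.≟ j) then accept else reject)

  pairTest-accepts : ∀ (i j : Fin n) ν →
    (pmf ν i + pmf ν j) * Pr[ pairTest i j accepts ν ] ≈ pmf ν j
  pairTest-accepts i j ν with i Fin.≟ j
  ... | yes ≡.refl = C.trans
    (solve 2 (λ a h → (a :+ a) :* (h :* (:1 :+ # 0)) := h :* (a :+ a)) C.refl (pmf ν i) (fromℕ 2 ⁻¹))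
    (half+half (pmf ν i))
  ... | no i≢j = begin-equality
    (pmf ν i + pmf ν j) * sum (λ l → γ l * Pr[ (if does (l Fin.≟ j) then accept else reject) accepts ν ])
      ≈⟨ C.*-congˡ (sum-cong-≋ (λ l → lemma l (does (l Fin.≟ j)))) ⟩
    (pmf ν i + pmf ν j) * sum (λ l → if does (l Fin.≟ j) then γ l else 0#)
      ≈⟨ C.*-cong (mass-pair ν i≢j) (C.sym (sum-δ γ j)) ⟨
    mass ν (pair i j) * γ j
      ≈⟨ mass*conditional ν (pair i j) j (∈-pair i j) ⟩
    pmf ν j ∎
    where
    γ = conditional ν (pair i j)
    lemma : ∀ l b → γ l * Pr[ (if b then accept {q = 0} else reject) accepts ν ] ≈
                    (if b then γ l else 0#)
    lemma l true  = C.*-identityʳ _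
    lemma l false = C.zeroʳ _

  sampleTest : Fin n → Algorithm n 2
  sampleTest i = query ⊤ (i , ∈⊤) (pairTest i)

  -- The coin tosses select one of 2 ^ k indices; those beyond n reject, which
  -- scales the acceptance probability by the known factor n / 2 ^ k.
  collisionTest : ∀ n → ℕ → Algorithm n 2
  collisionTest n k = tosses k (pad sampleTest reject)

  score : Distribution n → Fin n → Fin n → ℝ
  score ν i j = pmf ν j * Pr[ pairTest i j accepts ν ]

  total : Distribution n → ℝ
  total ν = sum λ i → sum λ j → score ν i j

  collisionTest-accepts : ∀ k → n ℕ.≤ 2 ℕ.^ k → ∀ (ν : Distribution n) →
    fromℕ (2 ℕ.^ k) * Pr[ collisionTest n k accepts ν ] ≈ total ν
  collisionTest-accepts {n} k n≤2^k ν = begin-equality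
    fromℕ (2 ℕ.^ k) * Pr[ collisionTest _ k accepts ν ]
      ≈⟨ tosses-accepts k _ ν ⟩
    sum {2 ℕ.^ k} (λ i → Pr[ pad sampleTest reject (Fin.toℕ i) accepts ν ])
      ≈⟨ sum-pad (λ T → Pr[ T accepts ν ]) sampleTest {reject} C.refl n≤2^k ⟩
    sum (λ i → Pr[ sampleTest i accepts ν ])
      ≈⟨ sum-cong-≋ {n} (λ i → sum-cong-≋ {n} (λ j → C.*-congʳ (conditional-⊤ ν j))) ⟩
    total ν ∎

  sum-affine : ∀ α γ (ν : Distribution n) → sum (λ j → α * pmf ν j + γ) ≈ α + fromℕ n * γ
  sum-affine {n} α γ ν = begin-equality
    sum (λ j → α * pmf ν j + γ)                 ≈⟨ ∑-distrib-+ (λ j → α * pmf ν j) _ ⟩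
    sum (λ j → α * pmf ν j) + sum {n} (λ _ → γ)
      ≈⟨ C.+-cong (C.sym (*-distribˡ-sum α (pmf ν))) (sum-const n γ) ⟩
    α * sum (pmf ν) + fromℕ n * γ               ≈⟨ C.+-congʳ (C.*-congˡ (pmf-sum ν)) ⟩
    α * 1# + fromℕ n * γ                        ≈⟨ C.+-congʳ (C.*-identityʳ α) ⟩
    α + fromℕ n * γ                             ∎

  -- With b = pmf ν j and s = pmf ν i + pmf ν j, the tangent bound
  -- 16 b² / s ≥ 8 ρ b - ρ² s.
  score-lower : ∀ ρ (ν : Distribution n) i j →
    (0# - ρ * ρ) * pmf ν i + (fromℕ 8 * ρ - ρ * ρ) * pmf ν j ≤ fromℕ 16 * score ν i j
  score-lower ρ ν i j = certify _
    (+-nonNeg (*-nonNeg (+-nonNeg (pmf-nonNeg ν i) (pmf-nonNeg ν j)) (x²-nonNeg (fromℕ 4 * r - ρ)))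
              (0≤c*[y-x] (fromℕ 16 * r - fromℕ 8 * ρ) (pairTest-accepts i j ν)))
    (solve 4 (λ a b r ρ → # 16 :* (b :* r) :=
      (# 0 :- ρ :* ρ) :* a :+ (# 8 :* ρ :- ρ :* ρ) :* b :+
        ((a :+ b) :* ((# 4 :* r :- ρ) :* (# 4 :* r :- ρ)) :+
         (# 16 :* r :- # 8 :* ρ) :* (b :- (a :+ b) :* r))) C.refl
      (pmf ν i) (pmf ν j) r ρ)
    where r = Pr[ pairTest i j accepts ν ]

  16*total : ∀ (ν : Distribution n) → fromℕ 16 * total ν ≈ sum λ i → sum λ j → fromℕ 16 * score ν i j
  16*total ν = C.trans (*-distribˡ-sum (fromℕ 16) (λ i → sum (score ν i)))
    (sum-cong-≋ λ i → *-distribˡ-sum (fromℕ 16) (score ν i))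

  -- Upper and lower bounds on the total score

  module _ {n} {ε u : ℝ} (nu≈1 : fromℕ n * u ≈ 1#) (0<u : 0# < u)
           (0≤ε : 0# ≤ ε) (ε≤1 : ε ≤ 1#) where

    -- A deviation of at most ε u / 4, split into two linear inequalities so that their differences
    -- can be multiplied in certificates.
    NearUniform : Distribution n → Set
    NearUniform μ = ∀ i → (fromℕ 4 * (pmf μ i - u) ≤ ε * u) × (fromℕ 4 * (u - pmf μ i) ≤ ε * u)

    -- With s = a + b, the quotient 16 b² / s equals 12 b - 4 a + 4 (a - b)² / s. Nearness bounds
    -- the difference of a and b by ε u / 2, and s ≥ u, so the last term is at most ε² u.
    score-upper : ∀ (μ : Distribution n) → NearUniform μ → ∀ i j →
      fromℕ 16 * score μ i j ≤ fromℕ 12 * pmf μ j + (ε * ε * u - fromℕ 4 * pmf μ i)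
    score-upper μ near i j =
      *-cancelˡ-≤ s (0<x≤y⇒0<y 0<u u≤s) (*-cancelˡ-≤ (fromℕ 4) (0<fromℕ[1+n] 3) (certify _
        (+-nonNeg (+-nonNeg
          (*-nonNeg (*-nonNeg (*-nonNeg (fromℕ-nonNeg 4) (x²-nonNeg ε)) (proj₁ 0<u)) (x≤y⇒0≤y-x u≤s))
          (*-nonNeg (+-nonNeg a≤ b≥) (+-nonNeg a≥ b≤)))
          (0≤c*[y-x] (fromℕ 64 * b) (pairTest-accepts i j μ)))
        (solve 5 (λ a b r ε u → # 4 :* ((a :+ b) :* (# 12 :* b :+ (ε :* ε :* u :- # 4 :* a))) :=
          # 4 :* ((a :+ b) :* (# 16 :* (b :* r))) :+
            (# 4 :* (ε :* ε) :* u :* ((a :+ b) :- u) :+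
             ((ε :* u :- # 4 :* (a :- u)) :+ (ε :* u :- # 4 :* (u :- b))) :*
             ((ε :* u :- # 4 :* (u :- a)) :+ (ε :* u :- # 4 :* (b :- u))) :+
             # 64 :* b :* (b :- (a :+ b) :* r))) C.refl
          a b Pr[ pairTest i j accepts μ ] ε u)))
      where
      a = pmf μ i
      b = pmf μ j
      s = a + b
      a≤ = x≤y⇒0≤y-x (proj₁ (near i))
      a≥ = x≤y⇒0≤y-x (proj₂ (near i))
      b≤ = x≤y⇒0≤y-x (proj₁ (near j))
      b≥ = x≤y⇒0≤y-x (proj₂ (near j))
      u≤s : u ≤ s
      u≤s = *-cancelˡ-≤ (fromℕ 4) (0<fromℕ[1+n] 3) (certify _
        (+-nonNeg (+-nonNeg a≥ b≥)
          (*-nonNeg (*-nonNeg (fromℕ-nonNeg 2) (proj₁ 0<u)) (+-nonNeg 0≤1 (x≤y⇒0≤y-x ε≤1))))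
        (solve 4 (λ a b ε u → # 4 :* (a :+ b) := # 4 :* u :+
          ((ε :* u :- # 4 :* (u :- a)) :+ (ε :* u :- # 4 :* (u :- b)) :+
           # 2 :* u :* (:1 :+ (:1 :- ε)))) C.refl a b ε u))

    total-upper : ∀ μ → NearUniform μ → fromℕ 16 * total μ ≤ fromℕ n * (fromℕ 8 + ε * ε)
    total-upper μ near = begin
      fromℕ 16 * total μ
        ≈⟨ 16*total μ ⟩
      sum (λ i → sum λ j → fromℕ 16 * score μ i j)
        ≤⟨ sum-mono-≤ (λ i → sum-mono-≤ (score-upper μ near i)) ⟩
      sum (λ i → sum λ j → fromℕ 12 * pmf μ j + (ε * ε * u - fromℕ 4 * pmf μ i))
        ≈⟨ sum-cong-≋ (λ i → C.trans (sum-affine (fromℕ 12) _ μ)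
             (solve 4 (λ n a ε u → # 12 :+ n :* (ε :* ε :* u :- # 4 :* a) :=
               (# 0 :- # 4 :* n) :* a :+ (# 12 :+ n :* (ε :* ε :* u))) C.refl (fromℕ n) (pmf μ i) ε u)) ⟩
      sum (λ i → (0# - fromℕ 4 * fromℕ n) * pmf μ i + (fromℕ 12 + fromℕ n * (ε * ε * u)))
        ≈⟨ sum-affine (0# - fromℕ 4 * fromℕ n) _ μ ⟩
      (0# - fromℕ 4 * fromℕ n) + fromℕ n * (fromℕ 12 + fromℕ n * (ε * ε * u))
        ≤⟨ certify _ (0≤c*[y-x] (fromℕ n * (ε * ε)) nu≈1)
             (solve 3 (λ n ε u → n :* (# 8 :+ ε :* ε) :=
               (# 0 :- # 4 :* n) :+ n :* (# 12 :+ n :* (ε :* ε :* u)) :+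
                 n :* (ε :* ε) :* (:1 :- n :* u)) C.refl (fromℕ n) ε u) ⟩
      fromℕ n * (fromℕ 8 + ε * ε) ∎

    module _ (μ ν : Distribution n) (near : NearUniform μ) where

      private
        gap : Fin n → ℝ
        gap j = ∣ pmf μ j - pmf ν j ∣ᵣ

        -- Within a column the slope ρ does not depend on i, so summing over i uses only that ν has
        -- total mass 1. Of the 5 ε², one part is the squared tilt in the constant term, one pays
        -- for the deviation of μ from u, and three are slack.
        columnBound : Fin n → ℝ
        columnBound j = (fromℕ 12 - ε * ε) * fromℕ n * pmf ν j + (0# - (fromℕ 4 + fromℕ 5 * (ε * ε)))
          + fromℕ 4 * ε * fromℕ n * gap j

        -- Here σ is the sign of pmf ν j - pmf μ j, and score-lower is applied with
        -- ρ = 2 + ε σ: the slope 2 is the tangent at the uniform distribution, and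
        -- tilting it towards σ extracts ∣ pmf μ j - pmf ν j ∣ᵣ.
        column-lower′ : ∀ j σ → σ * σ ≈ 1# → gap j ≈ σ * (pmf ν j - pmf μ j) →
          0# ≤ fromℕ 4 * σ * (pmf μ j - u) + ε * u →
          columnBound j ≤ sum λ i → fromℕ 16 * score ν i j
        column-lower′ j σ σ²≈1 gap≈ near′ = begin
          columnBound j
            ≤⟨ certify _
                 (+-nonNeg (+-nonNeg (+-nonNeg (+-nonNeg (+-nonNeg
                   (0≤c*[y-x] (ε * ε * (1# + N * a)) σ²≈1)
                   (0≤c*[y-x] (fromℕ 4 * ε * N) gap≈))
                   (*-nonNeg (*-nonNeg 0≤ε (fromℕ-nonNeg n)) near′))
                   (0≤c*[y-x] (ε * (fromℕ 4 * σ)) (C.sym nu≈1)))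
                   (0≤c*[y-x] (ε * ε) nu≈1))
                   (*-nonNeg (fromℕ-nonNeg 3) (x²-nonNeg ε)))
                 (solve 7 (λ ε N a b u σ g → let ρ = # 2 :+ ε :* σ in
                   (# 0 :- ρ :* ρ) :+ N :* ((# 8 :* ρ :- ρ :* ρ) :* a) :=
                   (# 12 :- ε :* ε) :* N :* a :+ (# 0 :- (# 4 :+ # 5 :* (ε :* ε))) :+ # 4 :* ε :* N :* g :+
                   (ε :* ε :* (:1 :+ N :* a) :* (:1 :- σ :* σ) :+
                    # 4 :* ε :* N :* (σ :* (a :- b) :- g) :+
                    ε :* N :* (# 4 :* σ :* (b :- u) :+ ε :* u) :+
                    ε :* (# 4 :* σ) :* (N :* u :- :1) :+
                    ε :* ε :* (:1 :- N :* u) :+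
                    # 3 :* (ε :* ε))) C.refl ε N a (pmf μ j) u σ (gap j)) ⟩
          (0# - ρ * ρ) + N * ((fromℕ 8 * ρ - ρ * ρ) * a)
            ≈⟨ sum-affine (0# - ρ * ρ) _ ν ⟨
          sum (λ i → (0# - ρ * ρ) * pmf ν i + (fromℕ 8 * ρ - ρ * ρ) * a)
            ≤⟨ sum-mono-≤ (λ i → score-lower ρ ν i j) ⟩
          sum (λ i → fromℕ 16 * score ν i j) ∎
          where
          N = fromℕ n
          a = pmf ν j
          ρ = fromℕ 2 + ε * σ

        column-lower : ∀ j → columnBound j ≤ sum λ i → fromℕ 16 * score ν i j
        column-lower j with ⊔.⊔-sel (pmf μ j - pmf ν j) (- (pmf μ j - pmf ν j))
        ... | inj₁ gap≈ = column-lower′ j (- 1#)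
          (solve 0 (:- :1 :* :- :1 := :1) C.refl)
          (C.trans gap≈ (solve 2 (λ a b → b :- a := :- :1 :* (a :- b)) C.refl (pmf ν j) (pmf μ j)))
          (O.trans (x≤y⇒0≤y-x (proj₁ (near j)))
            (O.reflexive (solve 3 (λ b u ε →
              ε :* u :- # 4 :* (b :- u) := # 4 :* :- :1 :* (b :- u) :+ ε :* u) C.refl
              (pmf μ j) u ε)))
        ... | inj₂ gap≈ = column-lower′ j 1#
          (C.*-identityˡ 1#)
          (C.trans gap≈ (solve 2 (λ a b → :- (b :- a) := :1 :* (a :- b)) C.refl (pmf ν j) (pmf μ j)))
          (O.trans (x≤y⇒0≤y-x (proj₂ (near j)))
            (O.reflexive (solve 3 (λ b u ε →
              ε :* u :- # 4 :* (u :- b) := # 4 :* :1 :* (b :- u) :+ ε :* u) C.refl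
              (pmf μ j) u ε)))

      -- Summed over j, the gaps amount to at least 2 ε and contribute 8 n ε²; the remaining terms
      -- cost 6 n ε². What is left, 2 n ε², is twice the excess that `total-upper` allows.
      total-lower : ε ≤ distance μ ν → fromℕ n * (fromℕ 8 + fromℕ 2 * (ε * ε)) ≤ fromℕ 16 * total ν
      total-lower ε≤d = begin
        N * (fromℕ 8 + fromℕ 2 * (ε * ε))
          ≤⟨ certify _
               (*-nonNeg (*-nonNeg (*-nonNeg (fromℕ-nonNeg 4) 0≤ε) (fromℕ-nonNeg n)) (x≤y⇒0≤y-x 2ε≤))
               (solve 3 (λ ε N g →
                 (# 12 :- ε :* ε) :* N :+ N :* (# 0 :- (# 4 :+ # 5 :* (ε :* ε))) :+ # 4 :* ε :* N :* g :=
                 N :* (# 8 :+ # 2 :* (ε :* ε)) :+ # 4 :* ε :* N :* (g :- # 2 :* ε)) C.refl ε N (sum gap)) ⟩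
        α + N * γ + fromℕ 4 * ε * N * sum gap
          ≈⟨ C.+-cong (sum-affine α γ ν) (C.sym (*-distribˡ-sum (fromℕ 4 * ε * N) gap)) ⟨
        sum (λ j → α * pmf ν j + γ) + sum (λ j → fromℕ 4 * ε * N * gap j)
          ≈⟨ ∑-distrib-+ (λ j → α * pmf ν j + γ) (λ j → fromℕ 4 * ε * N * gap j) ⟨
        sum columnBound
          ≤⟨ sum-mono-≤ column-lower ⟩
        sum (λ j → sum λ i → fromℕ 16 * score ν i j)
          ≈⟨ ∑-comm (λ j i → fromℕ 16 * score ν i j) ⟩
        sum (λ i → sum λ j → fromℕ 16 * score ν i j)
          ≈⟨ 16*total ν ⟨
        fromℕ 16 * total ν ∎
        where
        N = fromℕ n
        α = (fromℕ 12 - ε * ε) * N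
        γ = 0# - (fromℕ 4 + fromℕ 5 * (ε * ε))
        2ε≤ : fromℕ 2 * ε ≤ sum gap
        2ε≤ = begin
          fromℕ 2 * ε ≤⟨ *-monoˡ-≤ _ (fromℕ-nonNeg 2) ε≤d ⟩
          fromℕ 2 * (fromℕ 2 ⁻¹ * sum gap) ≈⟨ C.*-assoc _ _ _ ⟨
          fromℕ 2 * fromℕ 2 ⁻¹ * sum gap ≈⟨ C.*-congʳ (⁻¹-inverseʳ⁺ (0<fromℕ[1+n] 1)) ⟩
          1# * sum gap ≈⟨ C.*-identityˡ _ ⟩
          sum gap ∎

-- Choice of parameters

-- A discrete intermediate value principle. Rounding to integers, bounding by powers of two and
-- choosing the number of coins are all instances.
crossing : {P : ℕ → Set} → (∀ k → Dec (P k)) → ¬ P 0 → ∀ n → P n → ∃[ k ] ¬ P k × P (suc k)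
crossing P? ¬P0 zero    Pn = contradiction Pn ¬P0
crossing P? ¬P0 (suc n) Pn with P? n
... | yes Pn′ = crossing P? ¬P0 n Pn′
... | no ¬Pn  = n , ¬Pn , Pn

n<2^n : ∀ n → n ℕ.< 2 ℕ.^ n
n<2^n zero    = ℕ.s≤s ℕ.z≤n
n<2^n (suc n) = ℕ.≤-trans (ℕ.+-mono-≤ (ℕ.>-nonZero⁻¹ (2 ℕ.^ n) {{ℕ.m^n≢0 2 n}}) (n<2^n n))
  (ℕ.+-monoʳ-≤ (2 ℕ.^ n) (ℕ.m≤m+n (2 ℕ.^ n) 0))

module Tester (R : RealField) where
  open Testing R
  open OrderedField R
  open Verdicts R
  open Amplification R
  open PairTest R
  open PartialOrderReasoning O.poset

  fromℕ≤2^ : ∀ n → fromℕ n ≤ fromℕ 2 ^ n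
  fromℕ≤2^ zero    = 0≤1
  fromℕ≤2^ (suc n) = begin
    1# + fromℕ n                  ≤⟨ +-mono-≤ (1≤2^ n) (fromℕ≤2^ n) ⟩
    fromℕ 2 ^ n + fromℕ 2 ^ n     ≈⟨ solve 1 (λ x → x :+ x := # 2 :* x) C.refl (fromℕ 2 ^ n) ⟩
    fromℕ 2 * fromℕ 2 ^ n         ∎
    where
    1≤2^ : ∀ n → 1# ≤ fromℕ 2 ^ n
    1≤2^ zero    = O.refl
    1≤2^ (suc n) = begin
      1#                    ≈⟨ C.*-identityˡ 1# ⟨
      1# * 1#               ≤⟨ *-mono-≤ 0≤1 (fromℕ-nonNeg 2) (1≤fromℕ[1+n] 1) (1≤2^ n) ⟩
      fromℕ 2 * fromℕ 2 ^ n ∎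

  -- The lower estimate limits the number of samples, the upper one the error; the same holds for
  -- the logarithm below.
  ⌈_⌉ : ∀ {x} → 0# < x → ∃[ e ] fromℕ e ≤ x × x ≤ fromℕ (suc e)
  ⌈_⌉ {x} (0≤x , 0≉x) with archimedean x
  ... | m , x≤m with crossing (λ e → x ≤? fromℕ e) (λ x≤0 → 0≉x (O.antisym 0≤x x≤0)) m x≤m
  ...   | e , x≰e , x≤1+e = e , ≰⇒≥ x≰e , x≤1+e

  1≤x⁻¹ : ∀ {x} → 0# < x → x ≤ 1# → 1# ≤ x ⁻¹
  1≤x⁻¹ {x} 0<x x≤1 = *-cancelˡ-≤ x 0<x (begin
    x * 1#   ≈⟨ C.*-identityʳ x ⟩
    x        ≤⟨ x≤1 ⟩
    1#       ≈⟨ ⁻¹-inverseʳ⁺ 0<x ⟨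
    x * x ⁻¹ ∎)

  -- An integer is a rational with denominator 1, so k itself lies in the cut whose supremum is the
  -- logarithm.
  log₂-lower : ∀ {x} (0<x : 0# < x) k → fromℕ 2 ^ k ≤ x → fromℕ k ≤ log₂ x 0<x
  log₂-lower {x} 0<x k 2^k≤x = proj₁ (log₂-isSupremum x 0<x) (cut k 0 0
    (begin-equality
      fromℕ k                                  ≈⟨ C.*-identityʳ (fromℕ k) ⟨
      fromℕ k * 1#                             ≈⟨ C.*-congˡ (⁻¹-inverseʳ⁺ (0<fromℕ[1+n] 0)) ⟨
      fromℕ k * (fromℕ 1 * fromℕ 1 ⁻¹)
        ≈⟨ solve 2 (λ k d → k :* (# 1 :* d) := (k :- # 0) :* d) C.refl (fromℕ k) (fromℕ 1 ⁻¹) ⟩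
      (fromℕ k - fromℕ 0) * fromℕ 1 ⁻¹         ∎)
    (O.trans 2^k≤x (O.reflexive (solve 1 (λ x → x := x :* :1 :* :1) C.refl x))))

  ⌈log₂_⌉ : ∀ {x} → ¬ (x ≤ 1#) → ∃[ k ] fromℕ 2 ^ k ≤ x × x ≤ fromℕ 2 ^ suc k
  ⌈log₂_⌉ {x} x≰1 with archimedean x
  ... | m , x≤m with crossing (λ k → x ≤? fromℕ 2 ^ k) x≰1 m (O.trans x≤m (fromℕ≤2^ m))
  ...   | k , x≰2^k , x≤2^1+k = k , ≰⇒≥ x≰2^k , x≤2^1+k

  1<x⁻¹ : ∀ {x} → 0# < x → x < 1# → ¬ (x ⁻¹ ≤ 1#)
  1<x⁻¹ {x} 0<x (x≤1 , x≉1) x⁻¹≤1 = x≉1 (O.antisym x≤1 (begin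
    1#       ≈⟨ ⁻¹-inverseʳ⁺ 0<x ⟨
    x * x ⁻¹ ≤⟨ *-monoˡ-≤ x (proj₁ 0<x) x⁻¹≤1 ⟩
    x * 1#   ≈⟨ C.*-identityʳ x ⟩
    x        ∎))

  ≤‖-‖∞ : ∀ {n} (f g : Vector ℝ n) i → ∣ f i - g i ∣ᵣ ≤ ‖ f - g ‖∞
  ≤‖-‖∞ f g Fin.zero    = ⊔.x≤x⊔y _ _
  ≤‖-‖∞ f g (Fin.suc i) = O.trans (≤‖-‖∞ (f ∘ Fin.suc) (g ∘ Fin.suc) i) (⊔.x≤y⊔x _ _)

  x≤∣x∣ : ∀ x → x ≤ ∣ x ∣ᵣ
  x≤∣x∣ x = ⊔.x≤x⊔y x (- x)

  -x≤∣x∣ : ∀ x → - x ≤ ∣ x ∣ᵣ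
  -x≤∣x∣ x = ⊔.x≤y⊔x x (- x)

  -- Threshold, margin and correctness of the tester

  module CollisionTester (n k : ℕ) (n≤2^k : suc n ℕ.≤ 2 ℕ.^ k) (2^k≤2n : 2 ℕ.^ k ℕ.≤ 2 ℕ.* suc n)
           {ε : ℝ} (0<ε : 0# < ε) (ε≤1 : ε ≤ 1#) where
    private
      N = fromℕ (suc n)
      P = fromℕ (2 ℕ.^ k)
      u = N ⁻¹
      B = collisionTest (suc n) k

      0<N : 0# < N
      0<N = 0<fromℕ[1+n] n

      nu≈1 : N * u ≈ 1#
      nu≈1 = ⁻¹-inverseʳ⁺ 0<N

      0<u : 0# < u
      0<u = ⁻¹-pos 0<N

      0≤ε : 0# ≤ ε
      0≤ε = proj₁ 0<ε

      N≤P : N ≤ P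
      N≤P = fromℕ-mono n≤2^k

      P≤2N : P ≤ fromℕ 2 * N
      P≤2N = O.trans (fromℕ-mono 2^k≤2n) (O.reflexive (fromℕ-* 2 (suc n)))

      0<P : 0# < P
      0<P = 0<x≤y⇒0<y 0<N N≤P

      0<32P : 0# < fromℕ 32 * P
      0<32P = *-pos (0<fromℕ[1+n] 31) 0<P

      0≤1-ε² : 0# ≤ 1# - ε * ε
      0≤1-ε² = O.trans (*-nonNeg (x≤y⇒0≤y-x ε≤1) (+-nonNeg 0≤1 0≤ε))
        (O.reflexive (solve 1 (λ ε → (:1 :- ε) :* (:1 :+ ε) := :1 :- ε :* ε) C.refl ε))

    -- The midpoint of the two bounds on the acceptance probability.
    threshold : ℝ
    threshold = N * (fromℕ 16 + fromℕ 3 * (ε * ε)) * (fromℕ 32 * P) ⁻¹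

    -- Half the distance between the two acceptance bounds is N ε² / (32 P), which is at least ε² /
    -- 64 because P ≤ 2 N. The margin 2 * `rate` required by `Threshold` is exactly ε² / 64.
    rate : ℝ
    rate = ε * ε * fromℕ 128 ⁻¹

    private
      t = threshold
      s = rate

      32Pt≈ : fromℕ 32 * P * t ≈ N * (fromℕ 16 + fromℕ 3 * (ε * ε))
      32Pt≈ = d*[x*d⁻¹]≈x _ 0<32P

    128*rate : fromℕ 128 * s ≈ ε * ε
    128*rate = d*[x*d⁻¹]≈x _ (0<fromℕ[1+n] 127)

    0≤threshold : 0# ≤ t
    0≤threshold = *-nonNeg
      (*-nonNeg (proj₁ 0<N) (+-nonNeg (fromℕ-nonNeg 16) (*-nonNeg (fromℕ-nonNeg 3) (x²-nonNeg ε))))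
      (proj₁ (⁻¹-pos 0<32P))

    threshold≤1 : t ≤ 1#
    threshold≤1 = *-cancelˡ-≤ (fromℕ 32 * P) 0<32P (certify _
      (+-nonNeg (+-nonNeg
        (*-nonNeg (+-nonNeg (fromℕ-nonNeg 16) (*-nonNeg (fromℕ-nonNeg 3) (x²-nonNeg ε))) (x≤y⇒0≤y-x N≤P))
        (*-nonNeg (+-nonNeg (fromℕ-nonNeg 13) (*-nonNeg (fromℕ-nonNeg 3) 0≤1-ε²)) (proj₁ 0<P)))
        (0≤c*[y-x] 1# 32Pt≈))
      (solve 4 (λ N P ε t → # 32 :* P :* :1 := # 32 :* P :* t :+
        ((# 16 :+ # 3 :* (ε :* ε)) :* (P :- N) :+
         (# 13 :+ # 3 :* (:1 :- ε :* ε)) :* P :+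
         :1 :* (N :* (# 16 :+ # 3 :* (ε :* ε)) :- # 32 :* P :* t))) C.refl N P ε t))

    0≤rate : 0# ≤ s
    0≤rate = *-nonNeg (x²-nonNeg ε) (proj₁ (⁻¹-pos (0<fromℕ[1+n] 127)))

    0≤1-rate² : 0# ≤ 1# - s * s
    0≤1-rate² = O.trans (*-nonNeg (x≤y⇒0≤y-x s≤1) (+-nonNeg 0≤1 0≤rate))
        (O.reflexive (solve 1 (λ ε → (:1 :- ε) :* (:1 :+ ε) := :1 :- ε :* ε) C.refl s))
      where
      s≤1 : s ≤ 1#
      s≤1 = *-cancelˡ-≤ (fromℕ 128) (0<fromℕ[1+n] 127) (certify _
        (+-nonNeg (+-nonNeg (fromℕ-nonNeg 127) 0≤1-ε²) (0≤c*[y-x] 1# 128*rate))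
        (solve 2 (λ s ε → # 128 :* :1 := # 128 :* s :+
          (# 127 :+ (:1 :- ε :* ε) :+ :1 :* (ε :* ε :- # 128 :* s))) C.refl s ε))

    private module A = Threshold t s 0≤threshold threshold≤1 0≤rate 0≤1-rate²

    tester : ∀ m → Algorithm (suc n) (m ℕ.* 2)
    tester = A.amplify B

    module _ (μ : Distribution (suc n)) (μ-near : NearUniform nu≈1 0<u 0≤ε ε≤1 μ) where

      accepts-upper : ∀ μ′ → μ′ ≐ μ → Pr[ B accepts μ′ ] + fromℕ 2 * s ≤ t
      -- Scaling by 64 P clears all denominators: the threshold becomes 32 N + 6 N ε² and the
      -- acceptance probability at most 32 N + 4 N ε². The remaining 2 N ε² covers ε² P, the scaled
      -- margin.
      accepts-upper μ′ μ′≐μ = *-cancelˡ-≤ P 0<P (*-cancelˡ-≤ (fromℕ 64) (0<fromℕ[1+n] 63) (certify _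
        (+-nonNeg (+-nonNeg (+-nonNeg (+-nonNeg
          (*-nonNeg (fromℕ-nonNeg 4) (x≤y⇒0≤y-x (total-upper nu≈1 0<u 0≤ε ε≤1 μ′ μ′-near)))
          (*-nonNeg (x²-nonNeg ε) (x≤y⇒0≤y-x P≤2N)))
          (0≤c*[y-x] (fromℕ 64) (collisionTest-accepts k n≤2^k μ′)))
          (0≤c*[y-x] P 128*rate))
          (0≤c*[y-x] (fromℕ 2) (C.sym 32Pt≈)))
        (solve 7 (λ N P ε t s F p → # 64 :* (P :* t) := # 64 :* (P :* (p :+ # 2 :* s)) :+
          (# 4 :* (N :* (# 8 :+ ε :* ε) :- # 16 :* F) :+ ε :* ε :* (# 2 :* N :- P) :+
           # 64 :* (F :- P :* p) :+ P :* (ε :* ε :- # 128 :* s) :+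
           # 2 :* (# 32 :* P :* t :- N :* (# 16 :+ # 3 :* (ε :* ε))))) C.refl
          N P ε t s (total μ′) Pr[ B accepts μ′ ])))
        where
        μ′-near : NearUniform nu≈1 0<u 0≤ε ε≤1 μ′
        μ′-near i =
          O.trans (O.reflexive (C.*-congˡ (C.+-congʳ (μ′≐μ i)))) (proj₁ (μ-near i)) ,
          O.trans (O.reflexive (C.*-congˡ (C.+-congˡ (C.-‿cong (μ′≐μ i))))) (proj₂ (μ-near i))

      accepts-lower : ∀ ν → ε ≤ distance μ ν → t + fromℕ 2 * s ≤ Pr[ B accepts ν ]
      accepts-lower ν ε≤d = *-cancelˡ-≤ P 0<P (*-cancelˡ-≤ (fromℕ 64) (0<fromℕ[1+n] 63) (certify _
        (+-nonNeg (+-nonNeg (+-nonNeg (+-nonNeg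
          (*-nonNeg (fromℕ-nonNeg 4) (x≤y⇒0≤y-x (total-lower nu≈1 0<u 0≤ε ε≤1 μ ν μ-near ε≤d)))
          (*-nonNeg (x²-nonNeg ε) (x≤y⇒0≤y-x P≤2N)))
          (0≤c*[y-x] (fromℕ 64) (C.sym (collisionTest-accepts k n≤2^k ν))))
          (0≤c*[y-x] P 128*rate))
          (0≤c*[y-x] (fromℕ 2) 32Pt≈))
        (solve 7 (λ N P ε t s F p → # 64 :* (P :* p) := # 64 :* (P :* (t :+ # 2 :* s)) :+
          (# 4 :* (# 16 :* F :- N :* (# 8 :+ # 2 :* (ε :* ε))) :+ ε :* ε :* (# 2 :* N :- P) :+
           # 64 :* (P :* p :- F) :+ P :* (ε :* ε :- # 128 :* s) :+
           # 2 :* (N :* (# 16 :+ # 3 :* (ε :* ε)) :- # 32 :* P :* t))) C.refl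
          N P ε t s (total ν) Pr[ B accepts ν ])))

      tester-correct : ∀ {δ} m → (1# - s * s) ^ m ≤ δ → TestsIdentity (tester m) μ ε δ
      tester-correct {δ} m error≤δ = record
        { completeness = λ μ′ μ′≐μ → 1-δ≤ (C.trans (C.+-comm _ _) (accepts+rejects (tester m) μ′))
            (O.trans (A.amplify-rejects B μ′ (accepts-upper μ′ μ′≐μ) m) error≤δ)
        ; soundness = λ ν ε≤d → 1-δ≤ (accepts+rejects (tester m) ν)
            (O.trans (A.amplify-accepts B ν (accepts-lower ν ε≤d) m) error≤δ)
        }
        where
        1-δ≤ : ∀ {x y} → x + y ≈ 1# → x ≤ δ → 1# - δ ≤ y
        1-δ≤ {x} {y} x+y≈1 x≤δ = certify _ (+-nonNeg (x≤y⇒0≤y-x x≤δ) (0≤c*[y-x] 1# (C.sym x+y≈1)))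
          (solve 3 (λ x y δ → y := :1 :- δ :+ ((δ :- x) :+ :1 :* (x :+ y :- :1))) C.refl x y δ)

    near-uniform : (μ : Distribution (suc n)) →
      ‖ pmf μ - U (suc n) ‖∞ ≤ ε * (fromℕ 100 * N) ⁻¹ → NearUniform nu≈1 0<u 0≤ε ε≤1 μ
    near-uniform μ close i =
      bound (O.trans (x≤∣x∣ _) ∣∣≤β) ,
      bound (O.trans
        (O.reflexive (solve 2 (λ a b → b :- a := :- (a :- b)) C.refl (pmf μ i) u))
        (O.trans (-x≤∣x∣ _) ∣∣≤β))
      where
      β = ε * (fromℕ 100 * N) ⁻¹
      ∣∣≤β = O.trans (≤‖-‖∞ (pmf μ) (U (suc n)) i) close
      0<100N : 0# < fromℕ 100 * N
      0<100N = *-pos (0<fromℕ[1+n] 99) 0<N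
      100Nβ≈ε : fromℕ 100 * N * β ≈ ε
      100Nβ≈ε = d*[x*d⁻¹]≈x ε 0<100N
      bound : ∀ {x} → x ≤ β → fromℕ 4 * x ≤ ε * u
      bound {x} x≤β = *-cancelˡ-≤ (fromℕ 100 * N) 0<100N (certify _
        (+-nonNeg (+-nonNeg (+-nonNeg
          (*-nonNeg (*-nonNeg (fromℕ-nonNeg 4) (proj₁ 0<100N)) (x≤y⇒0≤y-x x≤β))
          (0≤c*[y-x] (fromℕ 4) 100Nβ≈ε))
          (0≤c*[y-x] (fromℕ 100 * ε) (C.sym nu≈1)))
          -- The 96 is the difference between the constant 100 and the 4 in `NearUniform`.
          (*-nonNeg (fromℕ-nonNeg 96) 0≤ε))
        (solve 5 (λ N x ε u β → # 100 :* N :* (ε :* u) := # 100 :* N :* (# 4 :* x) :+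
          (# 4 :* (# 100 :* N) :* (β :- x) :+ # 4 :* (ε :- # 100 :* N :* β) :+
           # 100 :* ε :* (N :* u :- :1) :+ # 96 :* ε)) C.refl N x ε u β))

  -- The second bound keeps the chance of drawing an index outside the range at one half or less, so
  -- padding at most halves the advantage.
  dyadicSize : ∀ n → ∃[ k ] suc n ℕ.≤ 2 ℕ.^ k × 2 ℕ.^ k ℕ.≤ 2 ℕ.* suc n
  dyadicSize n with crossing (λ k → suc n ℕ.<? 2 ℕ.^ k) (λ { (ℕ.s≤s ()) }) (suc n) (n<2^n (suc n))
  ... | j , n≮2^j , n<2^1+j = suc j , ℕ.<⇒≤ n<2^1+j , ℕ.*-monoʳ-≤ 2 (ℕ.≮⇒≥ n≮2^j)

  -- An integer bound for 1 / `rate`²: since 1 / `rate` is 128 / ε² and e + 1 rounds ε⁻¹ up, this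
  -- many rounds halve the error.
  blocks : ℕ → ℕ
  blocks e = 128 ℕ.* (suc e ℕ.* suc e) ℕ.* (128 ℕ.* (suc e ℕ.* suc e))

  fromℕ-blocks : ∀ e → let E = fromℕ (suc e) in
    fromℕ (blocks e) ≈ fromℕ 128 * (E * E) * (fromℕ 128 * (E * E))
  fromℕ-blocks e = C.trans (fromℕ-* d d) (C.*-cong d≈ d≈)
    where
    d = 128 ℕ.* (suc e ℕ.* suc e)
    d≈ : fromℕ d ≈ fromℕ 128 * (fromℕ (suc e) * fromℕ (suc e))
    d≈ = C.trans (fromℕ-* 128 (suc e ℕ.* suc e)) (C.*-congˡ (fromℕ-* (suc e) (suc e)))

  -- From e + 1 ≤ 2 x follows 128 (e + 1)² ≤ 512 x². The square of this, times 2 samples per round,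
  -- gives the coefficient of x⁴ (1 + L).
  coefficient : ℝ
  coefficient = fromℕ 2 * (fromℕ 512 * fromℕ 512)

  sampleBound : Polynomial₂
  sampleBound = (coefficient , 4 , 0) ∷ (coefficient , 4 , 1) ∷ []

  sampleBound-correct : ∀ {x L} e k → 1# ≤ x → fromℕ e ≤ x → fromℕ k ≤ L →
    fromℕ (blocks e ℕ.* suc k ℕ.* 2) ≤ evaluate sampleBound x L
  sampleBound-correct {x} {L} e k 1≤x e≤x k≤L = begin
    fromℕ (blocks e ℕ.* suc k ℕ.* 2)
      ≈⟨ C.trans (fromℕ-* (blocks e ℕ.* suc k) 2) (C.*-congʳ (fromℕ-* (blocks e) (suc k))) ⟩
    fromℕ (blocks e) * fromℕ (suc k) * fromℕ 2
      ≈⟨ C.*-congʳ (C.*-congʳ (fromℕ-blocks e)) ⟩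
    D * (E * E) * (D * (E * E)) * fromℕ (suc k) * fromℕ 2
      ≤⟨ *-monoʳ-≤ (fromℕ 2) (fromℕ-nonNeg 2) (*-mono-≤ (fromℕ-nonNeg (suc k)) (*-nonNeg 0≤D*4x² 0≤D*4x²)
           (*-mono-≤ (*-nonNeg (fromℕ-nonNeg 128) (x²-nonNeg E)) 0≤D*4x² DE²≤ DE²≤)
           (+-mono-≤ O.refl k≤L)) ⟩
    D * (X * X) * (D * (X * X)) * (1# + L) * fromℕ 2
      ≈⟨ solve 2 (λ x L → let X = x :+ x in
           # 128 :* (X :* X) :* (# 128 :* (X :* X)) :* (:1 :+ L) :* # 2 :=
           # 2 :* (# 512 :* # 512) :* (x :^ 4) :* (L :^ 0) :+
             (# 2 :* (# 512 :* # 512) :* (x :^ 4) :* (L :^ 1) :+ # 0)) C.refl x L ⟩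
    evaluate sampleBound x L ∎
    where
    D = fromℕ 128
    E = fromℕ (suc e)
    X = x + x
    0≤D*4x² = *-nonNeg (fromℕ-nonNeg 128) (x²-nonNeg X)
    E≤X = +-mono-≤ 1≤x e≤x
    DE²≤ : D * (E * E) ≤ D * (X * X)
    DE²≤ = *-monoˡ-≤ D (fromℕ-nonNeg 128) (*-mono-≤ (fromℕ-nonNeg (suc e))
      (O.trans (fromℕ-nonNeg (suc e)) E≤X) E≤X E≤X)

  1≤blocks*rate² : ∀ {ε s} e → 0# < ε → ε ⁻¹ ≤ fromℕ (suc e) → fromℕ 128 * s ≈ ε * ε →
    1# ≤ fromℕ (blocks e) * (s * s)
  1≤blocks*rate² {ε} {s} e 0<ε ε⁻¹≤E 128s≈ε² = begin
    1#                            ≤⟨ 1≤[εE]⁴ ⟩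
    ε * E * (ε * E) * (ε * E * (ε * E))
      ≈⟨ solve 2 (λ ε E → ε :* E :* (ε :* E) :* (ε :* E :* (ε :* E)) :=
           (ε :* ε) :* (ε :* ε) :* (E :* E :* (E :* E))) C.refl ε E ⟩
    (ε * ε) * (ε * ε) * (E * E * (E * E)) ≈⟨ C.*-congʳ (C.*-cong 128s≈ε² 128s≈ε²) ⟨
    (D * s) * (D * s) * (E * E * (E * E))
      ≈⟨ solve 3 (λ D s E → (D :* s) :* (D :* s) :* (E :* E :* (E :* E)) :=
           D :* (E :* E) :* (D :* (E :* E)) :* (s :* s)) C.refl D s E ⟩
    D * (E * E) * (D * (E * E)) * (s * s) ≈⟨ C.*-congʳ (fromℕ-blocks e) ⟨
    fromℕ (blocks e) * (s * s) ∎
    where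
    D = fromℕ 128
    E = fromℕ (suc e)
    1≤x*y : ∀ {x y} → 1# ≤ x → 1# ≤ y → 1# ≤ x * y
    1≤x*y 1≤x 1≤y = O.trans (O.reflexive (C.sym (C.*-identityˡ 1#)))
      (*-mono-≤ 0≤1 (O.trans 0≤1 1≤x) 1≤x 1≤y)
    1≤εE : 1# ≤ ε * E
    1≤εE = O.trans (O.reflexive (C.sym (⁻¹-inverseʳ⁺ 0<ε))) (*-monoˡ-≤ ε (proj₁ 0<ε) ε⁻¹≤E)
    1≤[εE]⁴ = 1≤x*y (1≤x*y 1≤εE 1≤εE) (1≤x*y 1≤εE 1≤εE)

  identityTester : ∀ ε δ → 0# < ε → ε < 1# → (0<δ : 0# < δ) → δ < 1# →
    ∀ n (μ : Distribution n) → ‖ pmf μ - U n ‖∞ < ε * (fromℕ 100 * fromℕ n) ⁻¹ →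
    Σ[ q ∈ ℕ ]
      ((fromℕ q ≤ evaluate sampleBound (ε ⁻¹) (log₂ (δ ⁻¹) (⁻¹-pos 0<δ)))
       × (Σ[ T ∈ Algorithm n q ] TestsIdentity T μ ε δ))
  -- The empty set carries no distribution, as the empty sum is 0.
  identityTester ε δ 0<ε ε<1 0<δ δ<1 zero μ close = contradiction (pmf-sum μ) 0≉1
  identityTester ε δ 0<ε (ε≤1 , _) 0<δ δ<1 (suc n) μ (close , _)
    with dyadicSize n | ⌈ ⁻¹-pos 0<ε ⌉ | ⌈log₂ 1<x⁻¹ 0<δ δ<1 ⌉
  ... | k , n≤2^k , 2^k≤2n | e , e≤ε⁻¹ , ε⁻¹≤1+e | l , 2^l≤δ⁻¹ , δ⁻¹≤2^1+l =
    m ℕ.* 2 ,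
    sampleBound-correct e l (1≤x⁻¹ 0<ε ε≤1) e≤ε⁻¹ (log₂-lower (⁻¹-pos 0<δ) l 2^l≤δ⁻¹) ,
    tester m ,
    tester-correct μ (near-uniform μ close) m
      (decay (blocks e) (suc l) (x²-nonNeg rate) 0≤1-rate²
        (1≤blocks*rate² e 0<ε ε⁻¹≤1+e 128*rate) 0<δ δ⁻¹≤2^1+l)
    where
    open CollisionTester n k n≤2^k 2^k≤2n 0<ε ε≤1
    m = blocks e ℕ.* suc l

theorem3p1p2 : (R : RealField) → let open Testing R in
    Σ[ p ∈ Polynomial₂ ]
    (∀ (ε δ : ℝ) → 0# < ε → ε < 1# → (0<δ : 0# < δ) → δ < 1# →
    ∀ (n : ℕ) (μ : Distribution n) →
    ‖ pmf μ - U n ‖∞ < ε * (fromℕ 100 * fromℕ n) ⁻¹ →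
    Σ[ q ∈ ℕ ]
    ((fromℕ q ≤ evaluate p (ε ⁻¹) (log₂ (δ ⁻¹) (⁻¹-pos 0<δ)))
    × (Σ[ T ∈ Algorithm n q ] TestsIdentity T μ ε δ)))
theorem3p1p2 R = sampleBound , identityTester
  where open Tester R
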